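{- There is an absolute constant $C$ such that for every odd integer $p\ge 3$, every $k\in\mathbb{Z}_p$ and every $\epsilon\in(0,1)$, the Pollard Rho walk with parameter $k$ on $\mathbb{Z}_p$ has mixing time in separation distance satisfying $$\tau_s(\epsilon)\le C\,(\log p)^2\,\log(p/\epsilon).$$
   Context: The Pollard Rho walk with parameter $k$ on $\mathbb{Z}_p$ ($p$ odd) is the Markov chain which at each step moves from $i$ to $i+1$, to $i+k$, or to $2i$ (all modulo $p$), each with probability $1/3$ (probabilities of coinciding targets are added). Its stationary distribution $\pi$ is uniform on $\mathbb{Z}_p$. For a Markov chain with transition matrix $P$ on a finite state space $V$ and stationary distribution $\pi$, the mixing time in separation distance is $$\tau_s(\epsilon)=\min\Bigl\{n:\ \forall x,y\in V,\ 1-\frac{P^n(x,y)}{\pi(y)}\le\epsilon\Bigr\}.$$ Logarithms are natural. -}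

module Defs where

open import Data.Bool using (if_then_else_)
open import Data.Fin using (Fin; toℕ)
import Data.Fin as Fin
import Data.Integer as ℤ
import Data.Integer.Properties as ℤ
open import Data.Nat as ℕ using (ℕ; zero; suc)
import Data.Nat.Properties as ℕ
import Data.Nat.DivMod as ℕ
import Data.Rational.Unnormalised as ℚᵘ
import Data.Rational.Unnormalised.Properties as ℚᵘ
open import Data.Product using (∃-syntax; _×_; _,_; proj₁; proj₂)
open import Data.Rational
open import Data.Rational.Properties
open import Data.Rational.Solver using (module +-*-Solver)
open import Data.Sum using (inj₁; inj₂)
open import Algebra.Properties.CommutativeMonoid.Sum +-0-commutativeMonoid using (sum)
open import Relation.Binary.PropositionalEquality
open import Relation.Nullary using (does; yes; no; contradiction)

open +-*-Solver using (solve; _:+_; _:*_; _:-_; :-_; _:=_; con)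
open ≤-Reasoning

------------------------------------------------------------------------
-- Auxiliary facts about ℚ

-- The reciprocal, extended by the value 0 at 0.
inv : ℚ → ℚ
inv q with q ≟ 0ℚ
... | yes _   = 0ℚ
... | no q≢0 = (1/ q) {{≢-nonZero q≢0}}

inv-inverse : ∀ q → q ≢ 0ℚ → q * inv q ≡ 1ℚ
inv-inverse q q≢0 with q ≟ 0ℚ
... | yes q≡0 = contradiction q≡0 q≢0
... | no q≢0′ = *-inverseʳ q {{≢-nonZero q≢0′}}

>⇒≢0 : ∀ {q} → 0ℚ < q → q ≢ 0ℚ
>⇒≢0 0<q q≡0 = <⇒≢ 0<q (sym q≡0)

0<1 : 0ℚ < 1ℚ
0<1 = positive⁻¹ 1ℚ

*-mono-≤⁺ : ∀ {a b c d} → 0ℚ ≤ b → 0ℚ ≤ c → a ≤ b → c ≤ d → a * c ≤ b * d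
*-mono-≤⁺ {a} {b} {c} {d} 0≤b 0≤c a≤b c≤d =
  ≤-trans (*-monoʳ-≤-nonNeg c {{nonNegative 0≤c}} a≤b)
          (*-monoˡ-≤-nonNeg b {{nonNegative 0≤b}} c≤d)

0<* : ∀ {a b} → 0ℚ < a → 0ℚ < b → 0ℚ < a * b
0<* {a} {b} 0<a 0<b =
  positive⁻¹ (a * b) {{pos*pos⇒pos a {{positive 0<a}} b {{positive 0<b}}}}

0≤* : ∀ {a b} → 0ℚ ≤ a → 0ℚ ≤ b → 0ℚ ≤ a * b
0≤* {a} {b} 0≤a 0≤b =
  nonNegative⁻¹ (a * b) {{nonNeg*nonNeg⇒nonNeg a {{nonNegative 0≤a}} b {{nonNegative 0≤b}}}}

0<+ : ∀ {a b} → 0ℚ < a → 0ℚ < b → 0ℚ < a + b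
0<+ = +-mono-<

inv-pos : ∀ {q} → 0ℚ < q → 0ℚ < inv q
inv-pos {q} 0<q = *-cancelˡ-<-nonNeg q {{nonNegative (<⇒≤ 0<q)}}
  (subst₂ _<_ (sym (*-zeroʳ q)) (sym (inv-inverse q (>⇒≢0 0<q))) 0<1)

inv-antimono : ∀ {a b} → 0ℚ < a → a ≤ b → inv b ≤ inv a
inv-antimono {a} {b} 0<a a≤b = *-cancelˡ-≤-pos a {{positive 0<a}} (begin
  a * inv b ≤⟨ *-monoʳ-≤-nonNeg (inv b) {{nonNegative (<⇒≤ (inv-pos 0<b))}} a≤b ⟩
  b * inv b ≡⟨ inv-inverse b (>⇒≢0 0<b) ⟩
  1ℚ        ≡⟨ sym (inv-inverse a (>⇒≢0 0<a)) ⟩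
  a * inv a ∎)
  where
  0<b : 0ℚ < b
  0<b = <-≤-trans 0<a a≤b

quot : ∀ {δ s} → 0ℚ < δ → 0ℚ < s → ∃[ η ] (0ℚ < η × η * s ≡ δ)
quot {δ} {s} 0<δ 0<s = δ * inv s , 0<* 0<δ (inv-pos 0<s) , (begin-equality
  δ * inv s * s   ≡⟨ solve 3 (λ d i t → d :* i :* t := d :* (t :* i)) refl δ (inv s) s ⟩
  δ * (s * inv s) ≡⟨ cong (δ *_) (inv-inverse s (>⇒≢0 0<s)) ⟩
  δ * 1ℚ          ≡⟨ *-identityʳ δ ⟩
  δ ∎)

triangle : ∀ a b c → ∣ a - c ∣ ≤ ∣ a - b ∣ + ∣ b - c ∣
triangle a b c = subst (λ t → ∣ t ∣ ≤ ∣ a - b ∣ + ∣ b - c ∣)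
  (solve 3 (λ x y z → (x :- y) :+ (y :- z) := x :- z) refl a b c)
  (∣p+q∣≤∣p∣+∣q∣ (a - b) (b - c))

∣-∣-sym : ∀ a b → ∣ a - b ∣ ≡ ∣ b - a ∣
∣-∣-sym a b = trans (sym (∣-p∣≡∣p∣ (a - b)))
  (cong ∣_∣ (solve 2 (λ x y → :- (x :- y) := y :- x) refl a b))

p≤∣p∣ : ∀ p → p ≤ ∣ p ∣
p≤∣p∣ p with ≤-total 0ℚ p
... | inj₁ 0≤p = ≤-reflexive (sym (0≤p⇒∣p∣≡p 0≤p))
... | inj₂ p≤0 = ≤-trans p≤0 (0≤∣p∣ p)

∣∣≤ : ∀ {p r} → - r ≤ p → p ≤ r → ∣ p ∣ ≤ r
∣∣≤ {p} {r} -r≤p p≤r with ∣p∣≡p∨∣p∣≡-p p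
... | inj₁ e = ≤-trans (≤-reflexive e) p≤r
... | inj₂ e = begin
  ∣ p ∣     ≡⟨ e ⟩
  - p       ≤⟨ neg-antimono-≤ -r≤p ⟩
  - (- r)   ≡⟨ solve 1 (λ x → :- (:- x) := x) refl r ⟩
  r         ∎

half : ∀ {δ} → 0ℚ < δ → ∃[ η ] (0ℚ < η × η + η ≡ δ)
half {δ} 0<δ = ½ * δ , 0<* (positive⁻¹ ½) 0<δ ,
  solve 1 (λ d → con ½ :* d :+ con ½ :* d := d) refl δ

≤-+ʳ : ∀ a {b} → 0ℚ ≤ b → a ≤ a + b
≤-+ʳ a {b} 0≤b = subst (_≤ a + b) (+-identityʳ a) (+-monoʳ-≤ a 0≤b)

ι : ℕ → ℚ
ι zero    = 0ℚ
ι (suc n) = 1ℚ + ι n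

0≤ι : ∀ n → 0ℚ ≤ ι n
0≤ι zero    = ≤-refl
0≤ι (suc n) = +-mono-≤ (<⇒≤ 0<1) (0≤ι n)

ι≃ : ∀ n → toℚᵘ (ι n) ℚᵘ.≃ ℚᵘ.mkℚᵘ (ℤ.+ n) 0
ι≃ zero    = ℚᵘ.≃-refl
ι≃ (suc n) = ℚᵘ.≃-trans (toℚᵘ-homo-+ 1ℚ (ι n))
  (ℚᵘ.≃-trans (ℚᵘ.+-congʳ ℚᵘ.1ℚᵘ (ι≃ n))
    (ℚᵘ.*≡* (cong (λ k → (ℤ.+ 1 ℤ.+ k) ℤ.* ℤ.+ 1) (ℤ.*-identityʳ (ℤ.+ n)))))

archimedean : ∀ q → ∃[ n ] q ≤ ι n
archimedean q = ℤ.∣ ↥ q ∣ , toℚᵘ-cancel-≤ (ℚᵘ.≤-trans (bound q) (ℚᵘ.≤-reflexive (ℚᵘ.≃-sym (ι≃ ℤ.∣ ↥ q ∣))))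
  where
  bound : ∀ r → toℚᵘ r ℚᵘ.≤ ℚᵘ.mkℚᵘ (ℤ.+ ℤ.∣ ↥ r ∣) 0
  bound (mkℚ (ℤ.+ m)    d _) = ℚᵘ.*≤* (subst (ℤ._≤ ℤ.+ m ℤ.* ℤ.+ suc d) (sym (ℤ.*-identityʳ (ℤ.+ m)))
    (subst (ℤ.+ m ℤ.≤_) (ℤ.pos-* m (suc d)) (ℤ.+≤+ (ℕ.m≤m*n m (suc d)))))
  bound (mkℚ ℤ.-[1+ m ] d _) = ℚᵘ.*≤* ℤ.-≤+

------------------------------------------------------------------------
-- Real numbers: Cauchy sequences of rationals

Eventually : (ℕ → Set) → Set
Eventually P = ∃[ N ] ∀ n → N ℕ.≤ n → P n

both : ∀ {P Q R : ℕ → Set} → (∀ {n} → P n → Q n → R n) →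
       Eventually P → Eventually Q → Eventually R
both f (M , p) (N , q) = M ℕ.⊔ N , λ n le →
  f (p n (ℕ.≤-trans (ℕ.m≤m⊔n M N) le)) (q n (ℕ.≤-trans (ℕ.m≤n⊔m M N) le))

Cauchy : (ℕ → ℚ) → Set
Cauchy f = ∀ δ → 0ℚ < δ →
  ∃[ N ] ∀ m n → N ℕ.≤ m → N ℕ.≤ n → ∣ f m - f n ∣ ≤ δ

record ℝ : Set where
  constructor mkℝ
  field
    seq    : ℕ → ℚ
    cauchy : Cauchy seq

open ℝ public

infix 4 _≤ℝ_ _<ℝ_

_≤ℝ_ : ℝ → ℝ → Set
x ≤ℝ y = ∀ δ → 0ℚ < δ → Eventually λ n → seq x n ≤ seq y n + δ

_<ℝ_ : ℝ → ℝ → Set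
x <ℝ y = ∃[ δ ] (0ℚ < δ × Eventually λ n → seq x n + δ ≤ seq y n)

fromℚ : ℚ → ℝ
fromℚ q = mkℝ (λ _ → q) λ δ 0<δ → 0 , λ _ _ _ _ →
  ≤-trans (≤-reflexive (cong ∣_∣ (+-inverseʳ q))) (<⇒≤ 0<δ)

fromℕ : ℕ → ℝ
fromℕ n = fromℚ (ℤ.+ n / 1)

0ℝ 1ℝ : ℝ
0ℝ = fromℚ 0ℚ
1ℝ = fromℚ 1ℚ

infixl 6 _+ℝ_ _-ℝ_
infixl 7 _*ℝ_
infixr 8 _^ℝ_

_+ℝ_ : ℝ → ℝ → ℝ
x +ℝ y = mkℝ (λ n → seq x n + seq y n) λ δ 0<δ →
  let η , 0<η , η+η≡δ = half 0<δ
      M , p = cauchy x η 0<η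
      N , q = cauchy y η 0<η
  in M ℕ.⊔ N , λ m n le le′ → begin
    ∣ (seq x m + seq y m) - (seq x n + seq y n) ∣
      ≡⟨ cong ∣_∣ (solve 4 (λ a b c d → (a :+ b) :- (c :+ d) := (a :- c) :+ (b :- d)) refl
           (seq x m) (seq y m) (seq x n) (seq y n)) ⟩
    ∣ (seq x m - seq x n) + (seq y m - seq y n) ∣
      ≤⟨ ∣p+q∣≤∣p∣+∣q∣ (seq x m - seq x n) (seq y m - seq y n) ⟩
    ∣ seq x m - seq x n ∣ + ∣ seq y m - seq y n ∣
      ≤⟨ +-mono-≤
           (p m n (ℕ.≤-trans (ℕ.m≤m⊔n M N) le) (ℕ.≤-trans (ℕ.m≤m⊔n M N) le′))
           (q m n (ℕ.≤-trans (ℕ.m≤n⊔m M N) le) (ℕ.≤-trans (ℕ.m≤n⊔m M N) le′)) ⟩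
    η + η ≡⟨ η+η≡δ ⟩
    δ ∎

-ℝ_ : ℝ → ℝ
-ℝ x = mkℝ (λ n → - seq x n) λ δ 0<δ →
  let N , p = cauchy x δ 0<δ
  in N , λ m n le le′ → begin
    ∣ - seq x m - - seq x n ∣
      ≡⟨ cong ∣_∣ (solve 2 (λ a b → :- a :- :- b := b :- a) refl (seq x m) (seq x n)) ⟩
    ∣ seq x n - seq x m ∣
      ≤⟨ p n m le′ le ⟩
    δ ∎

_-ℝ_ : ℝ → ℝ → ℝ
x -ℝ y = x +ℝ (-ℝ y)

bounded : ∀ x → ∃[ B ] (0ℚ < B × Eventually λ n → ∣ seq x n ∣ ≤ B)
bounded x =
  let N , p = cauchy x 1ℚ 0<1
      B = ∣ seq x N ∣ + 1ℚ
  in B , <-≤-trans 0<1 (subst (1ℚ ≤_) (+-comm 1ℚ ∣ seq x N ∣) (≤-+ʳ 1ℚ (0≤∣p∣ (seq x N)))) ,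
     N , λ n le → begin
       ∣ seq x n ∣
         ≡⟨ cong ∣_∣ (solve 2 (λ a b → b := a :+ (b :- a)) refl (seq x N) (seq x n)) ⟩
       ∣ seq x N + (seq x n - seq x N) ∣
         ≤⟨ ∣p+q∣≤∣p∣+∣q∣ (seq x N) (seq x n - seq x N) ⟩
       ∣ seq x N ∣ + ∣ seq x n - seq x N ∣
         ≤⟨ +-monoʳ-≤ ∣ seq x N ∣ (p n N le ℕ.≤-refl) ⟩
       B ∎

_*ℝ_ : ℝ → ℝ → ℝ
x *ℝ y = mkℝ (λ n → seq x n * seq y n) λ δ 0<δ →
  let Bx , 0<Bx , K , bx = bounded x
      By , 0<By , L , by = bounded y
      η , 0<η , η*S≡δ = quot 0<δ (0<+ 0<Bx 0<By)
      M , p = cauchy x η 0<η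
      N , q = cauchy y η 0<η
      T = (K ℕ.⊔ L) ℕ.⊔ (M ℕ.⊔ N)
      K≤ = ℕ.≤-trans (ℕ.m≤m⊔n K L) (ℕ.m≤m⊔n (K ℕ.⊔ L) (M ℕ.⊔ N))
      L≤ = ℕ.≤-trans (ℕ.m≤n⊔m K L) (ℕ.m≤m⊔n (K ℕ.⊔ L) (M ℕ.⊔ N))
      M≤ = ℕ.≤-trans (ℕ.m≤m⊔n M N) (ℕ.m≤n⊔m (K ℕ.⊔ L) (M ℕ.⊔ N))
      N≤ = ℕ.≤-trans (ℕ.m≤n⊔m M N) (ℕ.m≤n⊔m (K ℕ.⊔ L) (M ℕ.⊔ N))
  in T , λ m n le le′ → begin
    ∣ seq x m * seq y m - seq x n * seq y n ∣
      ≡⟨ cong ∣_∣ (solve 4 (λ a b c d → a :* b :- c :* d := (a :- c) :* b :+ c :* (b :- d)) refl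
           (seq x m) (seq y m) (seq x n) (seq y n)) ⟩
    ∣ (seq x m - seq x n) * seq y m + seq x n * (seq y m - seq y n) ∣
      ≤⟨ ∣p+q∣≤∣p∣+∣q∣ ((seq x m - seq x n) * seq y m) (seq x n * (seq y m - seq y n)) ⟩
    ∣ (seq x m - seq x n) * seq y m ∣ + ∣ seq x n * (seq y m - seq y n) ∣
      ≡⟨ cong₂ _+_ (∣p*q∣≡∣p∣*∣q∣ (seq x m - seq x n) (seq y m))
                   (∣p*q∣≡∣p∣*∣q∣ (seq x n) (seq y m - seq y n)) ⟩
    ∣ seq x m - seq x n ∣ * ∣ seq y m ∣ + ∣ seq x n ∣ * ∣ seq y m - seq y n ∣
      ≤⟨ +-mono-≤
           (*-mono-≤⁺ (<⇒≤ 0<η) (0≤∣p∣ (seq y m))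
             (p m n (ℕ.≤-trans M≤ le) (ℕ.≤-trans M≤ le′)) (by m (ℕ.≤-trans L≤ le)))
           (*-mono-≤⁺ (<⇒≤ 0<Bx) (0≤∣p∣ (seq y m - seq y n))
             (bx n (ℕ.≤-trans K≤ le′)) (q m n (ℕ.≤-trans N≤ le) (ℕ.≤-trans N≤ le′))) ⟩
    η * By + Bx * η
      ≡⟨ solve 3 (λ e a b → e :* b :+ a :* e := e :* (a :+ b)) refl η Bx By ⟩
    η * (Bx + By)
      ≡⟨ η*S≡δ ⟩
    δ ∎

_^ℝ_ : ℝ → ℕ → ℝ
x ^ℝ zero  = 1ℝ
x ^ℝ suc n = x *ℝ x ^ℝ n

positive-bound : ∀ x → 0ℝ <ℝ x → ∃[ c ] (0ℚ < c × Eventually λ n → c ≤ seq x n)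
positive-bound x (c , 0<c , N , p) =
  c , 0<c , N , λ n le → subst (_≤ seq x n) (+-identityˡ c) (p n le)

-- As 0 < x, the terms of x are eventually nonzero, so that the value of inv at
-- 0 plays no role.
recip : (x : ℝ) → 0ℝ <ℝ x → ℝ
recip x 0<x = mkℝ (λ n → inv (seq x n)) λ δ 0<δ →
  let c , 0<c , K , above = positive-bound x 0<x
      M , p = cauchy x (δ * (c * c)) (0<* 0<δ (0<* 0<c 0<c))
  in K ℕ.⊔ M , λ m n le le′ →
    let a = seq x m
        b = seq x n
        c≤a = above m (ℕ.≤-trans (ℕ.m≤m⊔n K M) le)
        c≤b = above n (ℕ.≤-trans (ℕ.m≤m⊔n K M) le′)
        0<a = <-≤-trans 0<c c≤a
        0<b = <-≤-trans 0<c c≤b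
        D = inv a - inv b
        0≤ab = <⇒≤ (0<* 0<a 0<b)
        bound = begin
          ∣ D ∣ * (c * c)
            ≤⟨ *-monoˡ-≤-nonNeg ∣ D ∣ {{∣-∣-nonNeg D}}
                 (*-mono-≤⁺ (<⇒≤ 0<a) (<⇒≤ 0<c) c≤a c≤b) ⟩
          ∣ D ∣ * (a * b)
            ≡⟨ cong (∣ D ∣ *_) (sym (0≤p⇒∣p∣≡p 0≤ab)) ⟩
          ∣ D ∣ * ∣ a * b ∣
            ≡⟨ sym (∣p*q∣≡∣p∣*∣q∣ D (a * b)) ⟩
          ∣ D * (a * b) ∣
            ≡⟨ cong ∣_∣ (solve 4 (λ a b i j → (i :- j) :* (a :* b) := b :* (a :* i) :- a :* (b :* j))
                 refl a b (inv a) (inv b)) ⟩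
          ∣ b * (a * inv a) - a * (b * inv b) ∣
            ≡⟨ cong₂ (λ s t → ∣ b * s - a * t ∣) (inv-inverse a (>⇒≢0 0<a)) (inv-inverse b (>⇒≢0 0<b)) ⟩
          ∣ b * 1ℚ - a * 1ℚ ∣
            ≡⟨ cong₂ (λ s t → ∣ s - t ∣) (*-identityʳ b) (*-identityʳ a) ⟩
          ∣ b - a ∣
            ≤⟨ p n m (ℕ.≤-trans (ℕ.m≤n⊔m K M) le′) (ℕ.≤-trans (ℕ.m≤n⊔m K M) le) ⟩
          δ * (c * c) ∎
    in *-cancelʳ-≤-pos (c * c) {{positive (0<* 0<c 0<c)}} bound

fromℕ-pos : ∀ n .{{_ : ℕ.NonZero n}} → 0ℝ <ℝ fromℕ n
fromℕ-pos n = ℤ.+ n / 1 , positive⁻¹ (ℤ.+ n / 1) {{normalize-pos n 1}} , 0 , λ _ _ →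
  ≤-reflexive (+-identityˡ (ℤ.+ n / 1))

+ℝ-pos : ∀ {x y} → 0ℝ <ℝ x → 0ℝ <ℝ y → 0ℝ <ℝ x +ℝ y
+ℝ-pos {x} {y} 0<x 0<y =
  let c , 0<c , p = positive-bound x 0<x
      d , 0<d , q = positive-bound y 0<y
  in c + d , 0<+ 0<c 0<d ,
     both (λ {n} a b → subst (_≤ seq x n + seq y n) (sym (+-identityˡ (c + d))) (+-mono-≤ a b)) p q

*ℝ-pos : ∀ {x y} → 0ℝ <ℝ x → 0ℝ <ℝ y → 0ℝ <ℝ x *ℝ y
*ℝ-pos {x} {y} 0<x 0<y =
  let c , 0<c , p = positive-bound x 0<x
      d , 0<d , q = positive-bound y 0<y
  in c * d , 0<* 0<c 0<d ,
     both (λ {n} a b → subst (_≤ seq x n * seq y n) (sym (+-identityˡ (c * d)))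
       (*-mono-≤⁺ (≤-trans (<⇒≤ 0<c) a) (<⇒≤ 0<d) a b)) p q

recip-bound : ∀ x (0<x : 0ℝ <ℝ x) → ∃[ b ] (0ℚ < b × Eventually λ n → b ≤ inv (seq x n))
recip-bound x 0<x =
  let c , 0<c , p = positive-bound x 0<x
      B , 0<B , q = bounded x
  in inv B , inv-pos 0<B ,
     both (λ {n} c≤x x≤B → inv-antimono (<-≤-trans 0<c c≤x) (≤-trans (p≤∣p∣ (seq x n)) x≤B)) p q

recip-pos : ∀ {x} (0<x : 0ℝ <ℝ x) → 0ℝ <ℝ recip x 0<x
recip-pos {x} 0<x =
  let b , 0<b , p = recip-bound x 0<x
  in b , 0<b , proj₁ p , λ n le →
       subst (_≤ inv (seq x n)) (sym (+-identityˡ b)) (proj₂ p n le)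

_÷ℝ_[_] : ℝ → (y : ℝ) → 0ℝ <ℝ y → ℝ
x ÷ℝ y [ 0<y ] = x *ℝ recip y 0<y

÷ℝ-pos : ∀ {x y} → 0ℝ <ℝ x → (0<y : 0ℝ <ℝ y) → 0ℝ <ℝ x ÷ℝ y [ 0<y ]
÷ℝ-pos {x} {y} 0<x 0<y = *ℝ-pos {x} {recip y 0<y} 0<x (recip-pos {y} 0<y)

------------------------------------------------------------------------
-- The natural logarithm

-- Σ_{j < m} z^(2j+1) / (2j+1)
artanhSum : ℕ → ℝ → ℝ
artanhSum zero    z = 0ℝ
artanhSum (suc j) z =
  artanhSum j z +ℝ fromℚ (ℤ.+ 1 / suc (j ℕ.+ j)) *ℝ z ^ℝ suc (j ℕ.+ j)

private
  _^ℚ_ : ℚ → ℕ → ℚ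
  r ^ℚ zero  = 1ℚ
  r ^ℚ suc n = r * r ^ℚ n

  0≤^ : ∀ {r} → 0ℚ ≤ r → ∀ n → 0ℚ ≤ r ^ℚ n
  0≤^ 0≤r zero    = <⇒≤ 0<1
  0≤^ 0≤r (suc n) = 0≤* 0≤r (0≤^ 0≤r n)

  bernoulli : ∀ r → 0ℚ ≤ r → ∀ n → r ^ℚ n * (1ℚ + ι n * (1ℚ - r)) ≤ 1ℚ
  bernoulli r 0≤r zero = ≤-reflexive (solve 1 (λ r → con 1ℚ :* (con 1ℚ :+ con 0ℚ :* (con 1ℚ :- r)) := con 1ℚ) refl r)
  bernoulli r 0≤r (suc n) = begin
    r * r ^ℚ n * (1ℚ + (1ℚ + ι n) * (1ℚ - r))
      ≡⟨ solve 3 (λ r p i →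
           r :* p :* (con 1ℚ :+ (con 1ℚ :+ i) :* (con 1ℚ :- r))
           := p :* (con 1ℚ :+ i :* (con 1ℚ :- r))
              :- p :* ((con 1ℚ :+ i) :* ((con 1ℚ :- r) :* (con 1ℚ :- r)))) refl r (r ^ℚ n) (ι n) ⟩
    A - E
      ≤⟨ +-monoʳ-≤ A (neg-antimono-≤ 0≤E) ⟩
    A - 0ℚ
      ≡⟨ +-identityʳ A ⟩
    A
      ≤⟨ bernoulli r 0≤r n ⟩
    1ℚ ∎
    where
    A = r ^ℚ n * (1ℚ + ι n * (1ℚ - r))
    E = r ^ℚ n * ((1ℚ + ι n) * ((1ℚ - r) * (1ℚ - r)))
    0≤sq : ∀ t → 0ℚ ≤ t * t
    0≤sq t with ∣p∣≡p∨∣p∣≡-p t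
    ... | inj₁ e = subst (λ s → 0ℚ ≤ s * s) e (0≤* (0≤∣p∣ t) (0≤∣p∣ t))
    ... | inj₂ e = subst (0ℚ ≤_) (trans (cong (λ s → s * s) e) (solve 1 (λ t → :- t :* :- t := t :* t) refl t))
                     (0≤* (0≤∣p∣ t) (0≤∣p∣ t))
    0≤E : 0ℚ ≤ E
    0≤E = 0≤* (0≤^ 0≤r n) (0≤* (0≤ι (suc n)) (0≤sq (1ℚ - r)))

  power-small : ∀ r → 0ℚ ≤ r → 0ℚ < 1ℚ - r → ∀ δ → 0ℚ < δ → ∃[ n ] r ^ℚ n ≤ δ
  power-small r 0≤r 0<s δ 0<δ =
    let s = 1ℚ - r
        η , 0<η , η*δs≡1 = quot 0<1 (0<* 0<s 0<δ)
        n , η≤n = archimedean η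
        0≤p = 0≤^ 0≤r n
        0<sδ = 0<* 0<s 0<δ
        one≤ : 1ℚ ≤ (1ℚ + ι n * s) * δ
        one≤ = begin
          1ℚ ≡⟨ sym η*δs≡1 ⟩
          η * (s * δ) ≤⟨ *-monoʳ-≤-nonNeg (s * δ) {{nonNegative (<⇒≤ 0<sδ)}} η≤n ⟩
          ι n * (s * δ) ≤⟨ ≤-+ʳ (ι n * (s * δ)) (<⇒≤ 0<δ) ⟩
          ι n * (s * δ) + δ ≡⟨ solve 3 (λ i s d → i :* (s :* d) :+ d := (con 1ℚ :+ i :* s) :* d) refl (ι n) s δ ⟩
          (1ℚ + ι n * s) * δ ∎
    in n , (begin
      r ^ℚ n ≡⟨ sym (*-identityʳ (r ^ℚ n)) ⟩
      r ^ℚ n * 1ℚ ≤⟨ *-monoˡ-≤-nonNeg (r ^ℚ n) {{nonNegative 0≤p}} one≤ ⟩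
      r ^ℚ n * ((1ℚ + ι n * s) * δ) ≡⟨ sym (*-assoc (r ^ℚ n) (1ℚ + ι n * s) δ) ⟩
      r ^ℚ n * (1ℚ + ι n * s) * δ ≤⟨ *-monoʳ-≤-nonNeg δ {{nonNegative (<⇒≤ 0<δ)}} (bernoulli r 0≤r n) ⟩
      1ℚ * δ ≡⟨ *-identityˡ δ ⟩
      δ ∎)

  module _ (z : ℝ) (r : ℚ) (0≤r : 0ℚ ≤ r) (0<s : 0ℚ < 1ℚ - r) where
    private
      s : ℚ
      s = 1ℚ - r

      r≤1 : r ≤ 1ℚ
      r≤1 = subst (r ≤_) (solve 1 (λ r → r :+ (con 1ℚ :- r) := con 1ℚ) refl r) (≤-+ʳ r (<⇒≤ 0<s))

    module _ (n : ℕ) (∣z∣≤r : ∣ seq z n ∣ ≤ r) where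
      pow≤1 : ∀ i → ∣ seq (z ^ℝ i) n ∣ ≤ 1ℚ
      pow≤1 zero    = ≤-refl
      pow≤1 (suc i) = begin
        ∣ seq z n * seq (z ^ℝ i) n ∣     ≡⟨ ∣p*q∣≡∣p∣*∣q∣ (seq z n) (seq (z ^ℝ i) n) ⟩
        ∣ seq z n ∣ * ∣ seq (z ^ℝ i) n ∣ ≤⟨ *-mono-≤⁺ (<⇒≤ 0<1) (0≤∣p∣ (seq (z ^ℝ i) n)) (≤-trans ∣z∣≤r r≤1) (pow≤1 i) ⟩
        1ℚ * 1ℚ                          ≡⟨⟩
        1ℚ                               ∎

      pow≤r : ∀ j i → ∣ seq (z ^ℝ (j ℕ.+ i)) n ∣ ≤ r ^ℚ j
      pow≤r zero    i = pow≤1 i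
      pow≤r (suc j) i = begin
        ∣ seq z n * seq (z ^ℝ (j ℕ.+ i)) n ∣
          ≡⟨ ∣p*q∣≡∣p∣*∣q∣ (seq z n) (seq (z ^ℝ (j ℕ.+ i)) n) ⟩
        ∣ seq z n ∣ * ∣ seq (z ^ℝ (j ℕ.+ i)) n ∣
          ≤⟨ *-mono-≤⁺ 0≤r (0≤∣p∣ (seq (z ^ℝ (j ℕ.+ i)) n)) ∣z∣≤r (pow≤r j i) ⟩
        r * r ^ℚ j ∎

      coeff≤1 : ∀ k → ∣ ℤ.+ 1 / suc k ∣ ≤ 1ℚ
      coeff≤1 k = begin
        ∣ ℤ.+ 1 / suc k ∣  ≡⟨ 0≤p⇒∣p∣≡p (nonNegative⁻¹ (ℤ.+ 1 / suc k) {{normalize-nonNeg 1 (suc k)}}) ⟩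
        ℤ.+ 1 / suc k      ≤⟨ toℚᵘ-cancel-≤ (ℚᵘ.≤-respˡ-≃ (ℚᵘ.≃-sym (toℚᵘ-fromℚᵘ (ℚᵘ.mkℚᵘ (ℤ.+ 1) k)))
                                (ℚᵘ.*≤* (ℤ.+≤+ (ℕ.s≤s ℕ.z≤n)))) ⟩
        1ℚ                 ∎

      term≤ : ∀ j → ∣ seq (fromℚ (ℤ.+ 1 / suc (j ℕ.+ j)) *ℝ z ^ℝ suc (j ℕ.+ j)) n ∣ ≤ r ^ℚ j
      term≤ j = begin
        ∣ c * w ∣     ≡⟨ ∣p*q∣≡∣p∣*∣q∣ c w ⟩
        ∣ c ∣ * ∣ w ∣ ≤⟨ *-mono-≤⁺ (<⇒≤ 0<1) (0≤∣p∣ w) (coeff≤1 (j ℕ.+ j)) bound ⟩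
        1ℚ * r ^ℚ j   ≡⟨ *-identityˡ (r ^ℚ j) ⟩
        r ^ℚ j        ∎
        where
        c = ℤ.+ 1 / suc (j ℕ.+ j)
        w = seq (z ^ℝ suc (j ℕ.+ j)) n
        bound : ∣ w ∣ ≤ r ^ℚ j
        bound = subst (λ i → ∣ seq (z ^ℝ i) n ∣ ≤ r ^ℚ j) (ℕ.+-suc j j) (pow≤r j (suc j))

      tail : ∀ N i → ∣ seq (artanhSum (i ℕ.+ N) z) n - seq (artanhSum N z) n ∣ * s + r ^ℚ (i ℕ.+ N) ≤ r ^ℚ N
      tail N zero = ≤-reflexive (begin-equality
        ∣ S - S ∣ * s + r ^ℚ N ≡⟨ cong (λ t → ∣ t ∣ * s + r ^ℚ N) (+-inverseʳ S) ⟩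
        0ℚ * s + r ^ℚ N        ≡⟨ cong (_+ r ^ℚ N) (*-zeroˡ s) ⟩
        0ℚ + r ^ℚ N            ≡⟨ +-identityˡ (r ^ℚ N) ⟩
        r ^ℚ N                 ∎)
        where S = seq (artanhSum N z) n
      tail N (suc i) = begin
        ∣ (T + t) - S ∣ * s + r * p
          ≡⟨ cong (λ u → ∣ u ∣ * s + r * p) (solve 3 (λ T t S → (T :+ t) :- S := (T :- S) :+ t) refl T t S) ⟩
        ∣ (T - S) + t ∣ * s + r * p
          ≤⟨ +-monoˡ-≤ (r * p) (*-monoʳ-≤-nonNeg s {{nonNegative (<⇒≤ 0<s)}}
               (≤-trans (∣p+q∣≤∣p∣+∣q∣ (T - S) t) (+-monoʳ-≤ ∣ T - S ∣ (term≤ (i ℕ.+ N))))) ⟩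
        (∣ T - S ∣ + p) * s + r * p
          ≡⟨ solve 3 (λ d p r → (d :+ p) :* (con 1ℚ :- r) :+ r :* p := d :* (con 1ℚ :- r) :+ p) refl ∣ T - S ∣ p r ⟩
        ∣ T - S ∣ * s + p
          ≤⟨ tail N i ⟩
        r ^ℚ N ∎
        where
        S = seq (artanhSum N z) n
        T = seq (artanhSum (i ℕ.+ N) z) n
        t = seq (fromℚ (ℤ.+ 1 / suc ((i ℕ.+ N) ℕ.+ (i ℕ.+ N))) *ℝ z ^ℝ suc ((i ℕ.+ N) ℕ.+ (i ℕ.+ N))) n
        p = r ^ℚ (i ℕ.+ N)

      tail≤ : ∀ {δ} N → r ^ℚ N ≤ δ * s → ∀ m → N ℕ.≤ m →
              ∣ seq (artanhSum m z) n - seq (artanhSum N z) n ∣ ≤ δ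
      tail≤ {δ} N small m N≤m = *-cancelʳ-≤-pos s {{positive 0<s}} (begin
        D * s              ≤⟨ ≤-+ʳ (D * s) (0≤^ 0≤r m) ⟩
        D * s + r ^ℚ m     ≤⟨ subst (λ k → ∣ seq (artanhSum k z) n - seq (artanhSum N z) n ∣ * s + r ^ℚ k ≤ r ^ℚ N)
                                (ℕ.m∸n+n≡m N≤m) (tail N (m ℕ.∸ N)) ⟩
        r ^ℚ N             ≤⟨ small ⟩
        δ * s              ∎)
        where D = ∣ seq (artanhSum m z) n - seq (artanhSum N z) n ∣

    diagonal : Eventually (λ n → ∣ seq z n ∣ ≤ r) → Cauchy (λ n → seq (artanhSum n z) n)
    diagonal (K , bd) δ 0<δ =
      let η , 0<η , η+η≡δ = half 0<δ
          θ , 0<θ , θ+θ≡η = half 0<η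
          N , small = power-small r 0≤r 0<s (θ * s) (0<* 0<θ 0<s)
          L , q = cauchy (artanhSum N z) η 0<η
          T = K ℕ.⊔ (N ℕ.⊔ L)
          K≤ = ℕ.m≤m⊔n K (N ℕ.⊔ L)
          N≤ = ℕ.≤-trans (ℕ.m≤m⊔n N L) (ℕ.m≤n⊔m K (N ℕ.⊔ L))
          L≤ = ℕ.≤-trans (ℕ.m≤n⊔m N L) (ℕ.m≤n⊔m K (N ℕ.⊔ L))
      in T , λ m n le le′ →
        let A = seq (artanhSum m z) m
            B = seq (artanhSum N z) m
            C = seq (artanhSum N z) n
            E = seq (artanhSum n z) n
            AB = tail≤ m (bd m (ℕ.≤-trans K≤ le)) {θ} N small m (ℕ.≤-trans N≤ le)
            EC = tail≤ n (bd n (ℕ.≤-trans K≤ le′)) {θ} N small n (ℕ.≤-trans N≤ le′)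
            BC = q m n (ℕ.≤-trans L≤ le) (ℕ.≤-trans L≤ le′)
        in begin
          ∣ A - E ∣                         ≤⟨ triangle A B E ⟩
          ∣ A - B ∣ + ∣ B - E ∣             ≤⟨ +-monoʳ-≤ ∣ A - B ∣ (triangle B C E) ⟩
          ∣ A - B ∣ + (∣ B - C ∣ + ∣ C - E ∣)
            ≤⟨ +-mono-≤ AB (+-mono-≤ BC (subst (_≤ θ) (∣-∣-sym E C) EC)) ⟩
          θ + (η + θ)                       ≡⟨ solve 2 (λ t e → t :+ (e :+ t) := (t :+ t) :+ e) refl θ η ⟩
          (θ + θ) + η                       ≡⟨ cong (_+ η) θ+θ≡η ⟩
          η + η                             ≡⟨ η+η≡δ ⟩
          δ                                 ∎

-- artanh z = Σ_{j ≥ 0} z^(2j+1) / (2j+1) for -1 < z < 1.  The limit of the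
-- partial sums is formed by the diagonal, the convergence being uniform in the
-- terms of z.
artanh : (z : ℝ) → -ℝ 1ℝ <ℝ z → z <ℝ 1ℝ → ℝ
artanh z (δ , 0<δ , M , lo) (δ′ , 0<δ′ , N , hi) =
  mkℝ (λ n → seq (artanhSum n z) n)
      (diagonal z r 0≤r 0<s (K , bd))
  where
  s r : ℚ
  s = δ ⊓ δ′
  r = 1ℚ - s
  K : ℕ
  K = M ℕ.⊔ N
  bd : ∀ n → K ℕ.≤ n → ∣ seq z n ∣ ≤ r
  bd n le = ∣∣≤
    (begin
      - (1ℚ - s)  ≡⟨ solve 1 (λ s → :- (con 1ℚ :- s) := :- con 1ℚ :+ s) refl s ⟩
      - 1ℚ + s    ≤⟨ +-monoʳ-≤ (- 1ℚ) (p⊓q≤p δ δ′) ⟩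
      - 1ℚ + δ    ≤⟨ lo n (ℕ.≤-trans (ℕ.m≤m⊔n M N) le) ⟩
      seq z n     ∎)
    (begin
      seq z n           ≡⟨ solve 2 (λ z d → z := (z :+ d) :- d) refl (seq z n) δ′ ⟩
      seq z n + δ′ - δ′ ≤⟨ +-mono-≤ (hi n (ℕ.≤-trans (ℕ.m≤n⊔m M N) le)) (neg-antimono-≤ (p⊓q≤q δ δ′)) ⟩
      1ℚ - s            ∎)
  0≤r : 0ℚ ≤ r
  0≤r = ≤-trans (0≤∣p∣ (seq z K)) (bd K ℕ.≤-refl)
  0<s : 0ℚ < 1ℚ - r
  0<s = subst (0ℚ <_) (solve 1 (λ s → s := con 1ℚ :- (con 1ℚ :- s)) refl s) 0<⊓
    where
    0<⊓ : 0ℚ < δ ⊓ δ′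
    0<⊓ with ⊓-sel δ δ′
    ... | inj₁ e = subst (0ℚ <_) (sym e) 0<δ
    ... | inj₂ e = subst (0ℚ <_) (sym e) 0<δ′

1+-pos : ∀ {x} → 0ℝ <ℝ x → 0ℝ <ℝ x +ℝ 1ℝ
1+-pos {x} 0<x = +ℝ-pos {x} {1ℝ} 0<x (fromℕ-pos 1)

module _ (x : ℝ) (0<x : 0ℝ <ℝ x) where
  private
    x+1 = x +ℝ 1ℝ
    0<x+1 = 1+-pos {x} 0<x

    x+1-inverse : Eventually λ n → (seq x n + 1ℚ) * inv (seq x n + 1ℚ) ≡ 1ℚ
    x+1-inverse =
      let c , 0<c , N , p = positive-bound x+1 0<x+1
      in N , λ n le → inv-inverse (seq x n + 1ℚ) (>⇒≢0 (<-≤-trans 0<c (p n le)))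

  -- (x - 1) / (x + 1)
  cayley : ℝ
  cayley = (x -ℝ 1ℝ) *ℝ recip x+1 0<x+1

  -1<cayley : -ℝ 1ℝ <ℝ cayley
  -1<cayley =
    let c , 0<c , p = positive-bound x 0<x
        b , 0<b , q = recip-bound x+1 0<x+1
        0<cb = 0<* 0<c 0<b
    in c * b , 0<cb ,
       both (λ {n} (c≤x , b≤w) inverse →
         let X = seq x n
             w = inv (X + 1ℚ)
             0≤X = ≤-trans (<⇒≤ 0<c) c≤x
             0≤w = ≤-trans (<⇒≤ 0<b) b≤w
         in begin
           - 1ℚ + c * b              ≤⟨ +-monoʳ-≤ (- 1ℚ) (*-mono-≤⁺ 0≤X (<⇒≤ 0<b) c≤x b≤w) ⟩
           - 1ℚ + X * w              ≤⟨ ≤-+ʳ (- 1ℚ + X * w) (0≤* 0≤X 0≤w) ⟩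
           - 1ℚ + X * w + X * w      ≡⟨ cong (λ u → - u + X * w + X * w) (sym inverse) ⟩
           - ((X + 1ℚ) * w) + X * w + X * w
             ≡⟨ solve 2 (λ X w → :- ((X :+ con 1ℚ) :* w) :+ X :* w :+ X :* w := (X :- con 1ℚ) :* w) refl X w ⟩
           (X - 1ℚ) * w              ∎)
         (both _,_ p q) x+1-inverse

  cayley<1 : cayley <ℝ 1ℝ
  cayley<1 =
    let b , 0<b , q = recip-bound x+1 0<x+1
    in b , 0<b ,
       both (λ {n} b≤w inverse →
         let X = seq x n
             w = inv (X + 1ℚ)
             0≤w = ≤-trans (<⇒≤ 0<b) b≤w
         in begin
           (X - 1ℚ) * w + b       ≤⟨ +-monoʳ-≤ ((X - 1ℚ) * w) b≤w ⟩
           (X - 1ℚ) * w + w       ≤⟨ ≤-+ʳ ((X - 1ℚ) * w + w) 0≤w ⟩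
           (X - 1ℚ) * w + w + w   ≡⟨ solve 2 (λ X w → (X :- con 1ℚ) :* w :+ w :+ w := (X :+ con 1ℚ) :* w) refl X w ⟩
           (X + 1ℚ) * w           ≡⟨ inverse ⟩
           1ℚ                     ∎)
         q x+1-inverse

  -- log x = 2 artanh ((x - 1) / (x + 1)), valid for every x > 0
  log : ℝ
  log = fromℕ 2 *ℝ artanh cayley -1<cayley cayley<1

------------------------------------------------------------------------
-- Finite Markov chains

Matrix : ℕ → Set
Matrix n = Fin n → Fin n → ℚ

δ[_,_] : ∀ {n} → Matrix n
δ[ x , y ] = if does (x Fin.≟ y) then 1ℚ else 0ℚ

_^ᴹ_ : ∀ {n} → Matrix n → ℕ → Matrix n
(P ^ᴹ zero)  x y = δ[ x , y ]
(P ^ᴹ suc m) x y = sum λ z → P x z * (P ^ᴹ m) z y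

-- π is meant to be positive everywhere, so that multiplication by inv (π y) is
-- division by π y.
SeparatedWithin : ∀ {N} → Matrix N → (Fin N → ℚ) → ℝ → ℕ → Set
SeparatedWithin P π ε n =
  ∀ x y → fromℚ (1ℚ - (P ^ᴹ n) x y * inv (π y)) ≤ℝ ε

-- τ is the separation mixing time τₛ(ε), the least n with SeparatedWithin P π ε n.
IsMixingTime : ∀ {N} → Matrix N → (Fin N → ℚ) → ℝ → ℕ → Set
IsMixingTime P π ε τ =
  SeparatedWithin P π ε τ × (∀ n → SeparatedWithin P π ε n → τ ℕ.≤ n)

-- τₛ(ε) ≤ b.  For a real ε the comparison with ε is undecidable, so τₛ(ε) cannot
-- be defined as a function of ε; the first component says that the set whose
-- minimum is τₛ(ε) has an element ≤ b, the second that the minimum is ≤ b.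
MixingTimeAtMost : ∀ {N} → Matrix N → (Fin N → ℚ) → ℝ → ℝ → Set
MixingTimeAtMost P π ε b =
  (∃[ n ] (SeparatedWithin P π ε n × fromℕ n ≤ℝ b)) ×
  (∀ τ → IsMixingTime P π ε τ → fromℕ τ ≤ℝ b)

------------------------------------------------------------------------
-- The Pollard Rho walk on ℤ/p, with residues represented by Fin p

module _ (p : ℕ) .{{_ : ℕ.NonZero p}} where

  uniform : Fin p → ℚ
  uniform _ = ℤ.+ 1 / p

  pollardRho : Fin p → Matrix p
  pollardRho k i j = ℤ.+ 1 / 3 *
    (δ[ (toℕ i ℕ.+ 1) ℕ.mod p , j ] + δ[ (toℕ i ℕ.+ toℕ k) ℕ.mod p , j ]
      + δ[ (2 ℕ.* toℕ i) ℕ.mod p , j ])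

module Submission where

-- Let V be the ℓ²-norm squared of f on ℤ/p.  The moves are permutations, so V cannot
-- increase; for two steps it drops by a multiple of ‖f(2i+1) - f(i+2)‖² + ‖f(2i+2) - f(i+2)‖²,
-- the discrepancies of three of the nine words of two moves.  With g(t) = f(t+3) this is the
-- Dirichlet form of the edges t ~ 2t and t ~ 2t+1.  Following n ≈ log₂ p binary digits takes t
-- to 2ⁿt + d for any d < p, that is, to a uniform residue, and every intermediate map is a
-- bijection (p is odd); hence the Dirichlet form is at least a multiple of V / n² when f has
-- mean 0.  So V halves every O(log² p) steps, and O(log (p/ε)) halvings of the
-- variance of the kernel make every deviation from 1/p at most ε/p.

open import Defs
open import Data.Fin using (Fin; toℕ)
open import Data.Nat using (ℕ; NonZero; zero; suc; _≤_)
open import Data.Nat.Divisibility using (_∣_; m%n≡0⇒n∣m)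
open import Data.Product using (∃-syntax; _×_; _,_; proj₁; proj₂)
open import Relation.Nullary using (¬_; Dec; yes; no; contradiction)

import Data.Fin as Fin
import Data.Fin.Properties as Fin
import Data.Integer as ℤ
import Data.Integer.Properties as ℤ
import Data.Nat as ℕ
import Data.Nat.DivMod as ℕ
import Data.Nat.Properties as ℕ
import Data.Nat.Solver as ℕ
open import Data.Rational as ℚ using (ℚ; 0ℚ; 1ℚ; _+_; _*_; _-_; -_; _/_)
import Data.Rational.Properties as ℚ
import Data.Rational.Unnormalised as ℚᵘ
import Data.Rational.Unnormalised.Properties as ℚᵘ
open import Data.Rational.Solver using (module +-*-Solver)
open import Data.Sum using (_⊎_; inj₁; inj₂)
open import Relation.Binary.PropositionalEquality

open import Algebra.Properties.CommutativeMonoid.Sum ℚ.+-0-commutativeMonoid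
  using (sum; sum-cong-≗; sum-replicate-zero; ∑-distrib-+)

open +-*-Solver using (solve; _:+_; _:*_; _:-_; :-_; _:=_; con)
open ℚ.≤-Reasoning
open ℕ.+-*-Solver using () renaming (solve to solveℕ; con to conℕ; _:*_ to _⊠_; _:+_ to _⊞_; _:=_ to _≐_)

-- Rational arithmetic

-- One step would not do. The only comparison in it that is free of k is that of `g (i + 1)` with
-- `g (2 * i)`, and up to a translation this is the graph t ~ 2t alone, where 0 is joined only to
-- itself. The second step supplies the other digit. The move by k may be degenerate (it may fix
-- every point, or coincide with the move by 1), so contraction is drawn only from words that avoid
-- it; this makes the constants independent of k. Everything up to the final comparison is an
-- inequality between rationals. Squares are compared instead of norms, so no square root occurs.
-- Only lower bounds for the logarithm are required, since it enters only the upper bound on the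
-- number of steps. A real ε is given by approximations while the number of steps has to be one
-- natural number, so ε is first replaced by a rational `e` within a factor 2; that loss is absorbed
-- by the exponents of 2.

slack : ∀ {a b} → a ℚ.≤ b → 0ℚ ℚ.≤ b - a
slack {a} {b} a≤b = subst (ℚ._≤ b - a) (ℚ.+-inverseʳ a) (ℚ.+-monoˡ-≤ (- a) a≤b)

-- The usual way to a polynomial inequality below: `r` is the difference of the two sides, visibly
-- nonnegative, and the ring solver checks the identity.
≤-slack : ∀ {a b} r → 0ℚ ℚ.≤ r → a + r ≡ b → a ℚ.≤ b
≤-slack {a} r 0≤r eq = subst (a ℚ.≤_) eq (≤-+ʳ a 0≤r)

0≤+ : ∀ {a b} → 0ℚ ℚ.≤ a → 0ℚ ℚ.≤ b → 0ℚ ℚ.≤ a + b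
0≤+ = ℚ.+-mono-≤

sq : ℚ → ℚ
sq t = t * t

0≤sq : ∀ t → 0ℚ ℚ.≤ sq t
0≤sq t with ℚ.∣p∣≡p∨∣p∣≡-p t
... | inj₁ e = subst (λ s → 0ℚ ℚ.≤ sq s) e (0≤* (ℚ.0≤∣p∣ t) (ℚ.0≤∣p∣ t))
... | inj₂ e = subst (0ℚ ℚ.≤_) (trans (cong sq e) (solve 1 (λ t → :- t :* :- t := t :* t) refl t))
                 (0≤* (ℚ.0≤∣p∣ t) (ℚ.0≤∣p∣ t))

nat : ℕ → ℚ
nat n = ℤ.+ n / 1

nat≡ι : ∀ n → nat n ≡ ι n
nat≡ι n = ℚ.toℚᵘ-injective (ℚᵘ.≃-trans (ℚ.toℚᵘ-fromℚᵘ (ℚᵘ.mkℚᵘ (ℤ.+ n) 0)) (ℚᵘ.≃-sym (ι≃ n)))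

nat-suc : ∀ n → nat (suc n) ≡ 1ℚ + nat n
nat-suc n = trans (nat≡ι (suc n)) (cong (1ℚ +_) (sym (nat≡ι n)))

0≤nat : ∀ n → 0ℚ ℚ.≤ nat n
0≤nat n = subst (0ℚ ℚ.≤_) (sym (nat≡ι n)) (0≤ι n)

0<nat : ∀ n .{{_ : NonZero n}} → 0ℚ ℚ.< nat n
0<nat n = ℚ.positive⁻¹ (nat n) {{ℚ.normalize-pos n 1}}

nat-+ : ∀ m n → nat (m ℕ.+ n) ≡ nat m + nat n
nat-+ zero    n = sym (ℚ.+-identityˡ (nat n))
nat-+ (suc m) n = begin-equality
  nat (suc (m ℕ.+ n))    ≡⟨ nat-suc (m ℕ.+ n) ⟩
  1ℚ + nat (m ℕ.+ n)     ≡⟨ cong (1ℚ +_) (nat-+ m n) ⟩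
  1ℚ + (nat m + nat n)   ≡⟨ sym (ℚ.+-assoc 1ℚ (nat m) (nat n)) ⟩
  1ℚ + nat m + nat n     ≡⟨ cong (_+ nat n) (sym (nat-suc m)) ⟩
  nat (suc m) + nat n    ∎

nat-* : ∀ m n → nat (m ℕ.* n) ≡ nat m * nat n
nat-* zero    n = sym (ℚ.*-zeroˡ (nat n))
nat-* (suc m) n = begin-equality
  nat (n ℕ.+ m ℕ.* n)      ≡⟨ nat-+ n (m ℕ.* n) ⟩
  nat n + nat (m ℕ.* n)    ≡⟨ cong (nat n +_) (nat-* m n) ⟩
  nat n + nat m * nat n    ≡⟨ solve 2 (λ m n → n :+ m :* n := (con 1ℚ :+ m) :* n) refl (nat m) (nat n) ⟩
  (1ℚ + nat m) * nat n     ≡⟨ cong (_* nat n) (sym (nat-suc m)) ⟩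
  nat (suc m) * nat n      ∎

nat-mono : ∀ {m n} → m ≤ n → nat m ℚ.≤ nat n
nat-mono {m} {n} m≤n = ≤-slack (nat (n ℕ.∸ m)) (0≤nat (n ℕ.∸ m))
  (trans (sym (nat-+ m (n ℕ.∸ m))) (cong nat (ℕ.m+[n∸m]≡n m≤n)))

nat-cancel-≤ : ∀ {m n} → nat m ℚ.≤ nat n → m ≤ n
nat-cancel-≤ {m} {n} le with m ℕ.≤? n
... | yes m≤n = m≤n
... | no  m≰n = contradiction
  (ℚ.<-≤-trans (subst (ℚ._< 1ℚ + nat n) (ℚ.+-identityˡ (nat n)) (ℚ.+-monoˡ-< (nat n) 0<1))
    (ℚ.≤-trans (subst (ℚ._≤ nat m) (nat-suc n) (nat-mono (ℕ.≰⇒> m≰n))) le))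
  (ℚ.<-irrefl refl)

-- Finite sums

-- Summing over an initial segment of ℕ leaves arguments such as 2i + d unreduced modulo p. `Σ<≡sum`
-- links this to sums over `Fin`.
Σ< : ℕ → (ℕ → ℚ) → ℚ
Σ< zero    f = 0ℚ
Σ< (suc n) f = f 0 + Σ< n (λ i → f (suc i))

Σ<-cong : ∀ n {f g} → (∀ i → f i ≡ g i) → Σ< n f ≡ Σ< n g
Σ<-cong zero    f≗g = refl
Σ<-cong (suc n) f≗g = cong₂ _+_ (f≗g 0) (Σ<-cong n (λ i → f≗g (suc i)))

Σ<-mono : ∀ n {f g} → (∀ i → i ℕ.< n → f i ℚ.≤ g i) → Σ< n f ℚ.≤ Σ< n g
Σ<-mono zero    f≤g = ℚ.≤-refl
Σ<-mono (suc n) f≤g = ℚ.+-mono-≤ (f≤g 0 (ℕ.s≤s ℕ.z≤n)) (Σ<-mono n (λ i i<n → f≤g (suc i) (ℕ.s≤s i<n)))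

Σ<-const : ∀ n c → Σ< n (λ _ → c) ≡ nat n * c
Σ<-const zero    c = sym (ℚ.*-zeroˡ c)
Σ<-const (suc n) c = begin-equality
  c + Σ< n (λ _ → c)  ≡⟨ cong (c +_) (Σ<-const n c) ⟩
  c + nat n * c       ≡⟨ solve 2 (λ n c → c :+ n :* c := (con 1ℚ :+ n) :* c) refl (nat n) c ⟩
  (1ℚ + nat n) * c    ≡⟨ cong (_* c) (sym (nat-suc n)) ⟩
  nat (suc n) * c     ∎

Σ<-zero : ∀ n → Σ< n (λ _ → 0ℚ) ≡ 0ℚ
Σ<-zero n = trans (Σ<-const n 0ℚ) (ℚ.*-zeroʳ (nat n))

Σ<-nonNeg : ∀ n {f} → (∀ i → 0ℚ ℚ.≤ f i) → 0ℚ ℚ.≤ Σ< n f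
Σ<-nonNeg n {f} 0≤f = subst (ℚ._≤ Σ< n f) (Σ<-zero n) (Σ<-mono n (λ i _ → 0≤f i))

Σ<-+ : ∀ n f g → Σ< n (λ i → f i + g i) ≡ Σ< n f + Σ< n g
Σ<-+ zero    f g = refl
Σ<-+ (suc n) f g = trans (cong (f 0 + g 0 +_) (Σ<-+ n (λ i → f (suc i)) (λ i → g (suc i))))
  (solve 4 (λ a b c d → (a :+ b) :+ (c :+ d) := (a :+ c) :+ (b :+ d)) refl
    (f 0) (g 0) (Σ< n (λ i → f (suc i))) (Σ< n (λ i → g (suc i))))

Σ<-* : ∀ n c f → Σ< n (λ i → c * f i) ≡ c * Σ< n f
Σ<-* zero    c f = sym (ℚ.*-zeroʳ c)
Σ<-* (suc n) c f = trans (cong (c * f 0 +_) (Σ<-* n c (λ i → f (suc i))))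
  (sym (ℚ.*-distribˡ-+ c (f 0) (Σ< n (λ i → f (suc i)))))

Σ<-swap : ∀ m n (f : ℕ → ℕ → ℚ) → Σ< m (λ i → Σ< n (f i)) ≡ Σ< n (λ j → Σ< m (λ i → f i j))
Σ<-swap zero    n f = sym (Σ<-zero n)
Σ<-swap (suc m) n f = trans (cong (Σ< n (f 0) +_) (Σ<-swap m n (λ i → f (suc i))))
  (sym (Σ<-+ n (f 0) (λ j → Σ< m (λ i → f (suc i) j))))

Σ<-append : ∀ m n f → Σ< (m ℕ.+ n) f ≡ Σ< m f + Σ< n (λ i → f (m ℕ.+ i))
Σ<-append zero    n f = sym (ℚ.+-identityˡ (Σ< n f))
Σ<-append (suc m) n f = trans (cong (f 0 +_) (Σ<-append m n (λ i → f (suc i))))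
  (sym (ℚ.+-assoc (f 0) (Σ< m (λ i → f (suc i))) (Σ< n (λ i → f (suc m ℕ.+ i)))))

Σ<-last : ∀ n f → Σ< (suc n) f ≡ Σ< n f + f n
Σ<-last zero    f = ℚ.+-comm (f 0) 0ℚ
Σ<-last (suc n) f = trans (cong (f 0 +_) (Σ<-last n (λ i → f (suc i))))
  (sym (ℚ.+-assoc (f 0) (Σ< n (λ i → f (suc i))) (f (suc n))))

Σ<-parity : ∀ q f → Σ< (suc (q ℕ.+ q)) f ≡
            Σ< (suc q) (λ i → f (2 ℕ.* i)) + Σ< q (λ i → f (suc (2 ℕ.* i)))
Σ<-parity zero    f = sym (ℚ.+-identityʳ (f 0 + 0ℚ))
Σ<-parity (suc q) f = begin-equality
  f 0 + (f 1 + Σ< (q ℕ.+ suc q) f″)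
    ≡⟨ cong (λ n → f 0 + (f 1 + Σ< n f″)) (ℕ.+-suc q q) ⟩
  f 0 + (f 1 + Σ< (suc (q ℕ.+ q)) f″)
    ≡⟨ cong (λ s → f 0 + (f 1 + s)) (Σ<-parity q f″) ⟩
  f 0 + (f 1 + (Σ< (suc q) (λ i → f″ (2 ℕ.* i)) + Σ< q (λ i → f″ (suc (2 ℕ.* i)))))
    ≡⟨ cong₂ (λ s t → f 0 + (f 1 + (s + t)))
         (Σ<-cong (suc q) (λ i → cong f (sym (ℕ.*-suc 2 i))))
         (Σ<-cong q (λ i → cong (λ j → f (suc j)) (sym (ℕ.*-suc 2 i)))) ⟩
  f 0 + (f 1 + (evens + odds))
    ≡⟨ solve 4 (λ a b c d → a :+ (b :+ (c :+ d)) := (a :+ c) :+ (b :+ d)) refl (f 0) (f 1) evens odds ⟩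
  (f 0 + evens) + (f 1 + odds) ∎
  where
  f″ : ℕ → ℚ
  f″ i = f (2 ℕ.+ i)
  evens odds : ℚ
  evens = Σ< (suc q) (λ i → f (2 ℕ.* suc i))
  odds  = Σ< q (λ i → f (suc (2 ℕ.* suc i)))

term≤Σ< : ∀ n {f} → (∀ i → 0ℚ ℚ.≤ f i) → ∀ i → i ℕ.< n → f i ℚ.≤ Σ< n f
term≤Σ< (suc n) {f} 0≤f zero    _           = ≤-+ʳ (f 0) (Σ<-nonNeg n (λ i → 0≤f (suc i)))
term≤Σ< (suc n) {f} 0≤f (suc i) (ℕ.s≤s i<n) =
  ℚ.≤-trans (term≤Σ< n (λ i → 0≤f (suc i)) i i<n)
    (≤-slack (f 0) (0≤f 0) (ℚ.+-comm (Σ< n (λ i → f (suc i))) (f 0)))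

-- Periodic functions on ℕ model functions on ℤ/p

Periodic : ℕ → (ℕ → ℚ) → Set
Periodic p g = ∀ i → g (i ℕ.+ p) ≡ g i

periodic-* : ∀ {p g} → Periodic p g → ∀ c i → g (i ℕ.+ c ℕ.* p) ≡ g i
periodic-* {p} {g} per zero    i = cong g (ℕ.+-identityʳ i)
periodic-* {p} {g} per (suc c) i = begin-equality
  g (i ℕ.+ (p ℕ.+ c ℕ.* p))  ≡⟨ cong g (sym (ℕ.+-assoc i p (c ℕ.* p))) ⟩
  g (i ℕ.+ p ℕ.+ c ℕ.* p)    ≡⟨ periodic-* per c (i ℕ.+ p) ⟩
  g (i ℕ.+ p)                ≡⟨ per i ⟩
  g i                        ∎

periodic-affine : ∀ {p g} → Periodic p g → ∀ a d → Periodic p (λ i → g (a ℕ.* i ℕ.+ d))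
periodic-affine {p} {g} per a d i = trans
  (cong g (solveℕ 4 (λ a d i p → a ⊠ (i ⊞ p) ⊞ d ≐ a ⊠ i ⊞ d ⊞ a ⊠ p) refl a d i p))
  (periodic-* per a (a ℕ.* i ℕ.+ d))

periodic-translate : ∀ {p g} → Periodic p g → ∀ c → Periodic p (λ i → g (i ℕ.+ c))
periodic-translate {p} {g} per c i = trans
  (cong g (trans (ℕ.+-assoc i p c) (trans (cong (i ℕ.+_) (ℕ.+-comm p c)) (sym (ℕ.+-assoc i c p)))))
  (per (i ℕ.+ c))

-- Both sums complete to the one over 0, ..., p: by `g 0` in front, or by `g p = g 0` at the end.
Σ<-shift : ∀ {p g} → Periodic p g → Σ< p (λ i → g (suc i)) ≡ Σ< p g
Σ<-shift {p} {g} per = begin-equality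
  A              ≡⟨ solve 2 (λ A x → A := (x :+ A) :- x) refl A (g 0) ⟩
  g 0 + A - g 0  ≡⟨ cong (_- g 0) (trans (Σ<-last p g) (cong (Σ< p g +_) (per 0))) ⟩
  Σ< p g + g 0 - g 0 ≡⟨ solve 2 (λ B x → (B :+ x) :- x := B) refl (Σ< p g) (g 0) ⟩
  Σ< p g         ∎
  where
  A = Σ< p (λ i → g (suc i))

Σ<-translate : ∀ {p g} → Periodic p g → ∀ c → Σ< p (λ i → g (i ℕ.+ c)) ≡ Σ< p g
Σ<-translate {p} {g} per zero    = Σ<-cong p (λ i → cong g (ℕ.+-identityʳ i))
Σ<-translate {p} {g} per (suc c) = begin-equality
  Σ< p (λ i → g (i ℕ.+ suc c))  ≡⟨ Σ<-cong p (λ i → cong g (ℕ.+-suc i c)) ⟩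
  Σ< p (λ i → g (suc i ℕ.+ c))  ≡⟨ Σ<-shift (periodic-translate per c) ⟩
  Σ< p (λ i → g (i ℕ.+ c))      ≡⟨ Σ<-translate per c ⟩
  Σ< p g                        ∎

-- Doubling modulo an odd number and the Poincaré inequality

module _ (p q : ℕ) (p-odd : p ≡ suc (q ℕ.+ q)) where

  -- Doubling permutes the residues of an odd p = 2q + 1: for i ≤ q it gives the even numbers below
  -- p, and 2(q + 1 + i) = p + (2i + 1) wraps around to the odd ones.
  Σ<-double : ∀ {g} → Periodic p g → Σ< p (λ i → g (2 ℕ.* i)) ≡ Σ< p g
  Σ<-double {g} per = begin-equality
    Σ< p h
      ≡⟨ cong (λ n → Σ< n h) p-odd ⟩
    Σ< (suc q ℕ.+ q) h
      ≡⟨ Σ<-append (suc q) q h ⟩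
    Σ< (suc q) h + Σ< q (λ i → h (suc q ℕ.+ i))
      ≡⟨ cong (Σ< (suc q) h +_) (Σ<-cong q wrap) ⟩
    Σ< (suc q) h + Σ< q (λ i → g (suc (2 ℕ.* i)))
      ≡⟨ sym (Σ<-parity q g) ⟩
    Σ< (suc (q ℕ.+ q)) g
      ≡⟨ cong (λ n → Σ< n g) (sym p-odd) ⟩
    Σ< p g ∎
    where
    h : ℕ → ℚ
    h i = g (2 ℕ.* i)
    wrap : ∀ i → g (2 ℕ.* (suc q ℕ.+ i)) ≡ g (suc (2 ℕ.* i))
    wrap i = trans
      (cong g (trans
        (solveℕ 2 (λ q i → conℕ 2 ⊠ (conℕ 1 ⊞ q ⊞ i) ≐ conℕ 1 ⊞ conℕ 2 ⊠ i ⊞ (conℕ 1 ⊞ (q ⊞ q))) refl q i)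
        (cong (suc (2 ℕ.* i) ℕ.+_) (sym p-odd))))
      (per (suc (2 ℕ.* i)))

  Σ<-affine : ∀ {g} → Periodic p g → ∀ n d → Σ< p (λ i → g (2 ℕ.^ n ℕ.* i ℕ.+ d)) ≡ Σ< p g
  Σ<-affine {g} per zero d = trans
    (Σ<-cong p (λ i → cong (λ j → g (j ℕ.+ d)) (ℕ.+-identityʳ i))) (Σ<-translate per d)
  Σ<-affine {g} per (suc n) d = begin-equality
    Σ< p (λ i → g (2 ℕ.* 2 ℕ.^ n ℕ.* i ℕ.+ d))
      ≡⟨ Σ<-cong p (λ i → cong (λ j → g (j ℕ.+ d))
           (trans (cong (ℕ._* i) (ℕ.*-comm 2 (2 ℕ.^ n))) (ℕ.*-assoc (2 ℕ.^ n) 2 i))) ⟩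
    Σ< p (λ i → g (2 ℕ.^ n ℕ.* (2 ℕ.* i) ℕ.+ d))
      ≡⟨ Σ<-double (periodic-affine per (2 ℕ.^ n) d) ⟩
    Σ< p (λ i → g (2 ℕ.^ n ℕ.* i ℕ.+ d))
      ≡⟨ Σ<-affine per n d ⟩
    Σ< p g ∎

  -- The Dirichlet form of the graph with the edges t ~ 2t and t ~ 2t + 1.
  energyₛ : ℕ → (ℕ → ℚ) → ℚ
  energyₛ b g = Σ< p (λ t → sq (g (2 ℕ.* t ℕ.+ b) - g t))

  energy : (ℕ → ℚ) → ℚ
  energy g = energyₛ 0 g + energyₛ 1 g

  module _ {g : ℕ → ℚ} (per : Periodic p g) where

    energyₛ≤energy : ∀ b → b ℕ.< 2 → energyₛ b g ℚ.≤ energy g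
    energyₛ≤energy 0 _ = ≤-+ʳ (energyₛ 0 g) (Σ<-nonNeg p (λ t → 0≤sq (g (2 ℕ.* t ℕ.+ 1) - g t)))
    energyₛ≤energy 1 _ = ≤-slack (energyₛ 0 g) (Σ<-nonNeg p (λ t → 0≤sq (g (2 ℕ.* t ℕ.+ 0) - g t)))
      (ℚ.+-comm (energyₛ 1 g) (energyₛ 0 g))
    energyₛ≤energy (suc (suc b)) (ℕ.s≤s (ℕ.s≤s ()))

    -- The sum over all starting points t of the squared change of `g` along the path from t that
    -- reads the `n` binary digits of `d`, most significant first.
    displacement : ℕ → ℕ → ℚ
    displacement n d = Σ< p (λ t → sq (g (2 ℕ.^ n ℕ.* t ℕ.+ d) - g t))

    -- Appending the binary digit b to the word of d, by
    -- c (u + v)² + (u - c v)² = (c + 1) (u² + c v²).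
    displacement-step : ∀ n d b → b ℕ.< 2 →
      nat (suc n) * displacement (suc n) (2 ℕ.* d ℕ.+ b) ℚ.≤
      (1ℚ + nat (suc n)) * (displacement n d + nat (suc n) * energy g)
    displacement-step n d b b<2 = begin
      c * displacement (suc n) (2 ℕ.* d ℕ.+ b)
        ≡⟨ sym (Σ<-* p c (λ t → sq (g (2 ℕ.^ suc n ℕ.* t ℕ.+ (2 ℕ.* d ℕ.+ b)) - g t))) ⟩
      Σ< p (λ t → c * sq (g (2 ℕ.^ suc n ℕ.* t ℕ.+ (2 ℕ.* d ℕ.+ b)) - g t))
        ≤⟨ Σ<-mono p (λ t _ → pointwise t) ⟩
      Σ< p (λ t → (1ℚ + c) * (sq (u t) + c * sq (v t)))
        ≡⟨ Σ<-* p (1ℚ + c) (λ t → sq (u t) + c * sq (v t)) ⟩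
      (1ℚ + c) * Σ< p (λ t → sq (u t) + c * sq (v t))
        ≡⟨ cong ((1ℚ + c) *_) (trans (Σ<-+ p (λ t → sq (u t)) (λ t → c * sq (v t)))
             (cong (displacement n d +_) (trans (Σ<-* p c (λ t → sq (v t))) (cong (c *_) v-energy)))) ⟩
      (1ℚ + c) * (displacement n d + c * energyₛ b g)
        ≤⟨ ℚ.*-monoˡ-≤-nonNeg (1ℚ + c) {{ℚ.nonNegative 0≤1+c}} (ℚ.+-monoʳ-≤ (displacement n d)
             (ℚ.*-monoˡ-≤-nonNeg c {{ℚ.nonNegative (0≤nat (suc n))}} (energyₛ≤energy b b<2))) ⟩
      (1ℚ + c) * (displacement n d + c * energy g) ∎
      where
      c = nat (suc n)
      0≤1+c = 0≤+ (ℚ.<⇒≤ 0<1) (0≤nat (suc n))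
      s : ℕ → ℕ
      s t = 2 ℕ.^ n ℕ.* t ℕ.+ d
      u v : ℕ → ℚ
      u t = g (s t) - g t
      v t = g (2 ℕ.* s t ℕ.+ b) - g (s t)
      endpoint : ∀ t → 2 ℕ.^ suc n ℕ.* t ℕ.+ (2 ℕ.* d ℕ.+ b) ≡ 2 ℕ.* s t ℕ.+ b
      endpoint t = solveℕ 4 (λ a t d b →
        conℕ 2 ⊠ a ⊠ t ⊞ (conℕ 2 ⊠ d ⊞ b) ≐ conℕ 2 ⊠ (a ⊠ t ⊞ d) ⊞ b) refl (2 ℕ.^ n) t d b
      pointwise : ∀ t → c * sq (g (2 ℕ.^ suc n ℕ.* t ℕ.+ (2 ℕ.* d ℕ.+ b)) - g t) ℚ.≤
                  (1ℚ + c) * (sq (u t) + c * sq (v t))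
      pointwise t = ≤-slack (sq (u t - c * v t)) (0≤sq (u t - c * v t))
        (trans (cong (λ j → c * sq (g j - g t) + sq (u t - c * v t)) (endpoint t))
          (solve 4 (λ c x y z →
            c :* ((z :- x) :* (z :- x)) :+ ((y :- x) :- c :* (z :- y)) :* ((y :- x) :- c :* (z :- y))
            := (con 1ℚ :+ c) :* ((y :- x) :* (y :- x) :+ c :* ((z :- y) :* (z :- y))))
            refl c (g t) (g (s t)) (g (2 ℕ.* s t ℕ.+ b))))
      -- `v t` is the increment over the edge with digit `b` at the vertex `s t`, and `s` permutes
      -- the residues.
      v-energy : Σ< p (λ t → sq (v t)) ≡ energyₛ b g
      v-energy = Σ<-affine {λ t → sq (g (2 ℕ.* t ℕ.+ b) - g t)}
        (λ i → cong₂ (λ x y → sq (x - y)) (periodic-affine per 2 b i) (per i)) n d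

    -- The weight c = n + 1 closes the recursion: (c + 1)/c · (nc + c) = (n + 1)(n + 2). The order
    -- n² is that of Cauchy-Schwarz along a path of n edges, and c is nonzero already at n = 0.
    displacement-bound : ∀ n d → d ℕ.< 2 ℕ.^ n →
      displacement n d ℚ.≤ nat n * nat (suc n) * energy g
    displacement-bound zero zero _ = ℚ.≤-reflexive (begin-equality
      displacement 0 0
        ≡⟨ Σ<-cong p (λ t → trans (cong (λ j → sq (g j - g t)) (trans (ℕ.+-identityʳ (t ℕ.+ 0)) (ℕ.+-identityʳ t)))
             (cong sq (ℚ.+-inverseʳ (g t)))) ⟩
      Σ< p (λ _ → 0ℚ)
        ≡⟨ Σ<-zero p ⟩
      0ℚ
        ≡⟨ solve 2 (λ a e → con 0ℚ := con 0ℚ :* a :* e) refl (nat 1) (energy g) ⟩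
      nat 0 * nat 1 * energy g ∎)
    displacement-bound zero (suc d) (ℕ.s≤s ())
    displacement-bound (suc n) d d<2^n = ℚ.*-cancelˡ-≤-pos c {{ℚ.positive (0<nat (suc n))}} (begin
      c * displacement (suc n) d
        ≡⟨ cong (λ d → c * displacement (suc n) d) digits ⟩
      c * displacement (suc n) (2 ℕ.* (d ℕ./ 2) ℕ.+ d ℕ.% 2)
        ≤⟨ displacement-step n (d ℕ./ 2) (d ℕ.% 2) (ℕ.m%n<n d 2) ⟩
      (1ℚ + c) * (displacement n (d ℕ./ 2) + c * energy g)
        ≤⟨ ℚ.*-monoˡ-≤-nonNeg (1ℚ + c) {{ℚ.nonNegative (0≤+ (ℚ.<⇒≤ 0<1) (0≤nat (suc n)))}}
             (ℚ.+-monoˡ-≤ (c * energy g) (displacement-bound n (d ℕ./ 2)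
               (ℕ.m<n*o⇒m/o<n (subst (d ℕ.<_) (ℕ.*-comm 2 (2 ℕ.^ n)) d<2^n)))) ⟩
      (1ℚ + c) * (nat n * c * energy g + c * energy g)
        ≡⟨ solve 3 (λ c n e → (con 1ℚ :+ c) :* (n :* c :* e :+ c :* e) := c :* ((con 1ℚ :+ n) :* (con 1ℚ :+ c) :* e))
             refl c (nat n) (energy g) ⟩
      c * ((1ℚ + nat n) * (1ℚ + c) * energy g)
        ≡⟨ cong₂ (λ x y → c * (x * y * energy g)) (sym (nat-suc n)) (sym (nat-suc (suc n))) ⟩
      c * (nat (suc n) * nat (suc (suc n)) * energy g) ∎)
      where
      c = nat (suc n)
      digits : d ≡ 2 ℕ.* (d ℕ./ 2) ℕ.+ d ℕ.% 2
      digits = trans (ℕ.m≡m%n+[m/n]*n d 2)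
        (trans (ℕ.+-comm (d ℕ.% 2) (d ℕ./ 2 ℕ.* 2)) (cong (ℕ._+ d ℕ.% 2) (ℕ.*-comm (d ℕ./ 2) 2)))

    -- After expanding the square, each of the two pure terms gives the same sum of squares, by
    -- invariance under affine maps. In the cross term the sum over `d` comes first: for fixed `t`
    -- it runs over a full period and equals the mean, 0.
    Σ<-displacement : Σ< p g ≡ 0ℚ → ∀ n →
      Σ< p (displacement n) ≡ nat p * (nat 2 * Σ< p (λ t → sq (g t)))
    Σ<-displacement mean0 n = begin-equality
      Σ< p (displacement n)
        ≡⟨ Σ<-cong p expand ⟩
      Σ< p (λ d → nat 2 * V + - nat 2 * Σ< p (λ t → g t * g (a ℕ.* t ℕ.+ d)))
        ≡⟨ Σ<-+ p (λ _ → nat 2 * V) (λ d → - nat 2 * Σ< p (λ t → g t * g (a ℕ.* t ℕ.+ d))) ⟩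
      Σ< p (λ _ → nat 2 * V) + Σ< p (λ d → - nat 2 * Σ< p (λ t → g t * g (a ℕ.* t ℕ.+ d)))
        ≡⟨ cong₂ _+_ (Σ<-const p (nat 2 * V))
             (trans (Σ<-* p (- nat 2) (λ d → Σ< p (λ t → g t * g (a ℕ.* t ℕ.+ d)))) (cong (- nat 2 *_) correlation)) ⟩
      nat p * (nat 2 * V) + - nat 2 * 0ℚ
        ≡⟨ solve 1 (λ x → x :+ con (- nat 2) :* con 0ℚ := x) refl (nat p * (nat 2 * V)) ⟩
      nat p * (nat 2 * V) ∎
      where
      a = 2 ℕ.^ n
      V = Σ< p (λ t → sq (g t))
      expand : ∀ d → displacement n d ≡ nat 2 * V + - nat 2 * Σ< p (λ t → g t * g (a ℕ.* t ℕ.+ d))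
      expand d = begin-equality
        Σ< p (λ t → sq (g (a ℕ.* t ℕ.+ d) - g t))
          ≡⟨ Σ<-cong p (λ t → solve 2 (λ x y → (x :- y) :* (x :- y)
               := (x :* x :+ y :* y) :+ con (- nat 2) :* (y :* x)) refl (g (a ℕ.* t ℕ.+ d)) (g t)) ⟩
        Σ< p (λ t → (sq (g (a ℕ.* t ℕ.+ d)) + sq (g t)) + - nat 2 * (g t * g (a ℕ.* t ℕ.+ d)))
          ≡⟨ trans (Σ<-+ p (λ t → sq (g (a ℕ.* t ℕ.+ d)) + sq (g t)) (λ t → - nat 2 * (g t * g (a ℕ.* t ℕ.+ d))))
               (cong₂ _+_ (Σ<-+ p (λ t → sq (g (a ℕ.* t ℕ.+ d))) (λ t → sq (g t)))
                 (Σ<-* p (- nat 2) (λ t → g t * g (a ℕ.* t ℕ.+ d)))) ⟩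
        (Σ< p (λ t → sq (g (a ℕ.* t ℕ.+ d))) + V) + - nat 2 * Σ< p (λ t → g t * g (a ℕ.* t ℕ.+ d))
          ≡⟨ cong (_+ - nat 2 * Σ< p (λ t → g t * g (a ℕ.* t ℕ.+ d)))
               (trans (cong (_+ V) (Σ<-affine (λ i → cong sq (per i)) n d))
                 (solve 1 (λ v → v :+ v := con (nat 2) :* v) refl V)) ⟩
        nat 2 * V + - nat 2 * Σ< p (λ t → g t * g (a ℕ.* t ℕ.+ d)) ∎
      correlation : Σ< p (λ d → Σ< p (λ t → g t * g (a ℕ.* t ℕ.+ d))) ≡ 0ℚ
      correlation = begin-equality
        Σ< p (λ d → Σ< p (λ t → g t * g (a ℕ.* t ℕ.+ d)))
          ≡⟨ Σ<-swap p p (λ d t → g t * g (a ℕ.* t ℕ.+ d)) ⟩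
        Σ< p (λ t → Σ< p (λ d → g t * g (a ℕ.* t ℕ.+ d)))
          ≡⟨ Σ<-cong p (λ t → begin-equality
               Σ< p (λ d → g t * g (a ℕ.* t ℕ.+ d))
                 ≡⟨ Σ<-* p (g t) (λ d → g (a ℕ.* t ℕ.+ d)) ⟩
               g t * Σ< p (λ d → g (a ℕ.* t ℕ.+ d))
                 ≡⟨ cong (g t *_) (trans (Σ<-cong p (λ d → cong g (ℕ.+-comm (a ℕ.* t) d)))
                      (trans (Σ<-translate per (a ℕ.* t)) mean0)) ⟩
               g t * 0ℚ
                 ≡⟨ ℚ.*-zeroʳ (g t) ⟩
               0ℚ ∎) ⟩
        Σ< p (λ _ → 0ℚ)
          ≡⟨ Σ<-zero p ⟩
        0ℚ ∎

    -- As d runs over p consecutive integers, 2ⁿ t + d runs over all residues, and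
    -- each such d < 2ⁿ is a binary word of length n.
    poincaré : .{{NonZero p}} → Σ< p g ≡ 0ℚ → ∀ n → p ≤ 2 ℕ.^ n →
      nat 2 * Σ< p (λ t → sq (g t)) ℚ.≤ nat n * nat (suc n) * energy g
    poincaré mean0 n p≤2^n = ℚ.*-cancelˡ-≤-pos (nat p) {{ℚ.positive (0<nat p)}} (begin
      nat p * (nat 2 * Σ< p (λ t → sq (g t)))
        ≡⟨ sym (Σ<-displacement mean0 n) ⟩
      Σ< p (displacement n)
        ≤⟨ Σ<-mono p (λ d d<p → displacement-bound n d (ℕ.<-≤-trans d<p p≤2^n)) ⟩
      Σ< p (λ _ → nat n * nat (suc n) * energy g)
        ≡⟨ Σ<-const p (nat n * nat (suc n) * energy g) ⟩
      nat p * (nat n * nat (suc n) * energy g) ∎)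

-- Contraction of the walk

moves : ℕ → (ℕ → ℚ) → ℕ → ℚ
moves k g i = g (i ℕ.+ 1) + g (i ℕ.+ k) + g (2 ℕ.* i)

step : ℕ → (ℕ → ℚ) → ℕ → ℚ
step k g i = ℤ.+ 1 / 3 * moves k g i

-- Powers of the transition operator, acting on functions of the starting point; on the indicator of
-- y they give the column of y in the power of the matrix.
walk : ℕ → ℕ → (ℕ → ℚ) → ℕ → ℚ
walk k zero    g = g
walk k (suc m) g = step k (walk k m g)

periodic-double : ∀ {p g} → Periodic p g → Periodic p (λ i → g (2 ℕ.* i))
periodic-double {p} {g} per i = trans (cong g (ℕ.*-distribˡ-+ 2 i p)) (periodic-* per 2 (2 ℕ.* i))

periodic-moves : ∀ {p g} k → Periodic p g → Periodic p (moves k g)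
periodic-moves k per i = cong₂ _+_
  (cong₂ _+_ (periodic-translate per 1 i) (periodic-translate per k i)) (periodic-double per i)

periodic-walk : ∀ {p g} k m → Periodic p g → Periodic p (walk k m g)
periodic-walk k zero    per = per
periodic-walk k (suc m) per i = cong (ℤ.+ 1 / 3 *_) (periodic-moves k (periodic-walk k m per) i)

walk-− : ∀ k m g u i → walk k m (λ i → g i - u) i ≡ walk k m g i - u
walk-− k zero    g u i = refl
walk-− k (suc m) g u i = trans
  (cong (ℤ.+ 1 / 3 *_) (cong₂ _+_ (cong₂ _+_ (walk-− k m g u (i ℕ.+ 1)) (walk-− k m g u (i ℕ.+ k))) (walk-− k m g u (2 ℕ.* i))))
  (solve 4 (λ x y z u → con (ℤ.+ 1 / 3) :* ((x :- u) :+ (y :- u) :+ (z :- u))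
    := con (ℤ.+ 1 / 3) :* (x :+ y :+ z) :- u) refl
    (walk k m g (i ℕ.+ 1)) (walk k m g (i ℕ.+ k)) (walk k m g (2 ℕ.* i)) u)

sq-sum₃ : ∀ a b c → sq (a + b + c) ≡ nat 3 * (sq a + sq b + sq c) - (sq (a - b) + sq (a - c) + sq (b - c))
sq-sum₃ = solve 3 (λ a b c → (a :+ b :+ c) :* (a :+ b :+ c) :=
  con (nat 3) :* (a :* a :+ b :* b :+ c :* c)
    :- ((a :- b) :* (a :- b) :+ (a :- c) :* (a :- c) :+ (b :- c) :* (b :- c))) refl

sq-sum₃-≤ : ∀ a b c → sq (a + b + c) ℚ.≤ nat 3 * (sq a + sq b + sq c)
sq-sum₃-≤ a b c = ≤-slack (sq (a - b) + sq (a - c) + sq (b - c))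
  (0≤+ (0≤+ (0≤sq (a - b)) (0≤sq (a - c))) (0≤sq (b - c)))
  (trans (cong (_+ D) (sq-sum₃ a b c)) (solve 2 (λ x d → x :- d :+ d := x) refl (nat 3 * (sq a + sq b + sq c)) D))
  where
  D = sq (a - b) + sq (a - c) + sq (b - c)

-- The discrepancy of the words x ↦ x + 2, x ↦ 2 (x + 1) and x ↦ 2 x + 1 of two moves.
discrepancy : (ℕ → ℚ) → ℕ → ℚ
discrepancy g i = sq (g (2 ℕ.* i ℕ.+ 1) - g (i ℕ.+ 1 ℕ.+ 1)) + sq (g (2 ℕ.* (i ℕ.+ 1)) - g (i ℕ.+ 1 ℕ.+ 1))

-- Cauchy-Schwarz twice: over three triples that partition the nine words, then inside each triple.
-- Only the triple `x`, whose words avoid k, keeps its defect, and of its three differences the two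
-- in `discrepancy`. The constant 1/27 is 3/81: the defect is multiplied by the outer 3 and divided
-- by the square of 9.
step²-bound : ∀ k g i → sq (step k (step k g) i) + ℤ.+ 1 / 27 * discrepancy g i ℚ.≤
              ℤ.+ 1 / 9 * moves k (moves k (λ j → sq (g j))) i
step²-bound k g i = begin
  sq (step k (step k g) i) + ℤ.+ 1 / 27 * D
    ≡⟨ cong (_+ ℤ.+ 1 / 27 * D) (regroup a₁ a₂ a₃ b₁ b₂ b₃ c₁ c₂ c₃) ⟩
  ℤ.+ 1 / 81 * sq (x + y + z) + ℤ.+ 1 / 27 * D
    ≤⟨ ℚ.+-monoˡ-≤ (ℤ.+ 1 / 27 * D) (ℚ.*-monoˡ-≤-nonNeg (ℤ.+ 1 / 81) (ℚ.≤-trans (sq-sum₃-≤ x y z)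
         (ℚ.*-monoˡ-≤-nonNeg (nat 3) (ℚ.+-mono-≤ (ℚ.+-mono-≤ x-bound (sq-sum₃-≤ a₂ b₁ b₂)) (sq-sum₃-≤ b₃ c₂ c₃))))) ⟩
  ℤ.+ 1 / 81 * (nat 3 * (nat 3 * (sq a₁ + sq c₁ + sq a₃) - D + nat 3 * (sq a₂ + sq b₁ + sq b₂)
    + nat 3 * (sq b₃ + sq c₂ + sq c₃))) + ℤ.+ 1 / 27 * D
    ≡⟨ collect (sq a₁) (sq a₂) (sq a₃) (sq b₁) (sq b₂) (sq b₃) (sq c₁) (sq c₂) (sq c₃) D ⟩
  ℤ.+ 1 / 9 * moves k (moves k (λ j → sq (g j))) i ∎
  where
  -- The letter records the first move (a: +1, b: +k, c: doubling), the subscript the second move in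
  -- the same order.
  a₁ = g (i ℕ.+ 1 ℕ.+ 1)
  a₂ = g (i ℕ.+ 1 ℕ.+ k)
  a₃ = g (2 ℕ.* (i ℕ.+ 1))
  b₁ = g (i ℕ.+ k ℕ.+ 1)
  b₂ = g (i ℕ.+ k ℕ.+ k)
  b₃ = g (2 ℕ.* (i ℕ.+ k))
  c₁ = g (2 ℕ.* i ℕ.+ 1)
  c₂ = g (2 ℕ.* i ℕ.+ k)
  c₃ = g (2 ℕ.* (2 ℕ.* i))
  x = a₁ + c₁ + a₃
  y = a₂ + b₁ + b₂
  z = b₃ + c₂ + c₃
  D = discrepancy g i
  regroup : ∀ a₁ a₂ a₃ b₁ b₂ b₃ c₁ c₂ c₃ →
    sq (ℤ.+ 1 / 3 * (ℤ.+ 1 / 3 * (a₁ + a₂ + a₃) + ℤ.+ 1 / 3 * (b₁ + b₂ + b₃) + ℤ.+ 1 / 3 * (c₁ + c₂ + c₃)))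
    ≡ ℤ.+ 1 / 81 * sq ((a₁ + c₁ + a₃) + (a₂ + b₁ + b₂) + (b₃ + c₂ + c₃))
  regroup a₁ a₂ a₃ b₁ b₂ b₃ c₁ c₂ c₃ = trans
    (cong sq (solve 9 (λ a₁ a₂ a₃ b₁ b₂ b₃ c₁ c₂ c₃ →
      con (ℤ.+ 1 / 3) :* (con (ℤ.+ 1 / 3) :* (a₁ :+ a₂ :+ a₃) :+ con (ℤ.+ 1 / 3) :* (b₁ :+ b₂ :+ b₃)
        :+ con (ℤ.+ 1 / 3) :* (c₁ :+ c₂ :+ c₃))
      := con (ℤ.+ 1 / 9) :* ((a₁ :+ c₁ :+ a₃) :+ (a₂ :+ b₁ :+ b₂) :+ (b₃ :+ c₂ :+ c₃)))
      refl a₁ a₂ a₃ b₁ b₂ b₃ c₁ c₂ c₃))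
    (solve 1 (λ s → con (ℤ.+ 1 / 9) :* s :* (con (ℤ.+ 1 / 9) :* s) := con (ℤ.+ 1 / 81) :* (s :* s)) refl
      ((a₁ + c₁ + a₃) + (a₂ + b₁ + b₂) + (b₃ + c₂ + c₃)))
  x-bound : sq x ℚ.≤ nat 3 * (sq a₁ + sq c₁ + sq a₃) - D
  x-bound = ≤-slack (sq (c₁ - a₃)) (0≤sq (c₁ - a₃))
    (solve 3 (λ a c d → (a :+ c :+ d) :* (a :+ c :+ d) :+ (c :- d) :* (c :- d) :=
      con (nat 3) :* (a :* a :+ c :* c :+ d :* d) :- ((c :- a) :* (c :- a) :+ (d :- a) :* (d :- a))) refl a₁ c₁ a₃)
  collect : ∀ a₁ a₂ a₃ b₁ b₂ b₃ c₁ c₂ c₃ D →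
    ℤ.+ 1 / 81 * (nat 3 * (nat 3 * (a₁ + c₁ + a₃) - D + nat 3 * (a₂ + b₁ + b₂) + nat 3 * (b₃ + c₂ + c₃))) + ℤ.+ 1 / 27 * D
    ≡ ℤ.+ 1 / 9 * ((a₁ + a₂ + a₃) + (b₁ + b₂ + b₃) + (c₁ + c₂ + c₃))
  collect = solve 10 (λ a₁ a₂ a₃ b₁ b₂ b₃ c₁ c₂ c₃ D →
    con (ℤ.+ 1 / 81) :* (con (nat 3) :* (con (nat 3) :* (a₁ :+ c₁ :+ a₃) :- D :+ con (nat 3) :* (a₂ :+ b₁ :+ b₂)
      :+ con (nat 3) :* (b₃ :+ c₂ :+ c₃))) :+ con (ℤ.+ 1 / 27) :* D
    := con (ℤ.+ 1 / 9) :* ((a₁ :+ a₂ :+ a₃) :+ (b₁ :+ b₂ :+ b₃) :+ (c₁ :+ c₂ :+ c₃))) refl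

-- From contraction by a factor 1 - 1/s to repeated halving

module _ (v : ℕ → ℚ) (0≤v : ∀ j → 0ℚ ℚ.≤ v j) (s : ℕ) .{{_ : NonZero s}}
         (contract : ∀ j → nat s * v (suc j) + v j ℚ.≤ nat s * v j) where

  -- This is (1 - 1/s)^j ≤ s/(s + j), a form of Bernoulli's inequality: the weighted value (s + j)
  -- v_j does not increase. At j = s it yields the factor 1/2 without exponentials.
  harmonic-decay : ∀ i j → (nat s + nat j) * v (j ℕ.+ i) ℚ.≤ nat s * v i
  harmonic-decay i zero = ℚ.≤-reflexive (cong (_* v i) (ℚ.+-identityʳ (nat s)))
  harmonic-decay i (suc j) = ℚ.*-cancelˡ-≤-pos S {{ℚ.positive (0<nat s)}} (begin
    S * ((S + nat (suc j)) * b)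
      ≡⟨ cong (λ n → S * ((S + n) * b)) (nat-suc j) ⟩
    S * ((S + (1ℚ + T)) * b)
      ≤⟨ ≤-slack ((S + (1ℚ + T)) * (S * a - (S * b + a)) + (1ℚ + T) * a)
           (0≤+ (0≤* (0≤+ (0≤nat s) 0≤1+T) (slack (contract (j ℕ.+ i)))) (0≤* 0≤1+T (0≤v (j ℕ.+ i))))
           (solve 4 (λ S T a b →
             S :* ((S :+ (con 1ℚ :+ T)) :* b)
               :+ ((S :+ (con 1ℚ :+ T)) :* (S :* a :- (S :* b :+ a)) :+ (con 1ℚ :+ T) :* a)
             := S :* ((S :+ T) :* a)) refl S T a b) ⟩
    S * ((S + T) * a)
      ≤⟨ ℚ.*-monoˡ-≤-nonNeg S {{ℚ.nonNegative (0≤nat s)}} (harmonic-decay i j) ⟩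
    S * (S * v i) ∎)
    where
    S = nat s
    T = nat j
    a = v (j ℕ.+ i)
    b = v (suc j ℕ.+ i)
    0≤1+T = 0≤+ (ℚ.<⇒≤ 0<1) (0≤nat j)

  halving : ∀ i → nat 2 * v (s ℕ.+ i) ℚ.≤ v i
  halving i = ℚ.*-cancelˡ-≤-pos (nat s) {{ℚ.positive (0<nat s)}}
    (subst (ℚ._≤ nat s * v i)
      (solve 2 (λ s v → (s :+ s) :* v := s :* (con (nat 2) :* v)) refl (nat s) (v (s ℕ.+ i)))
      (harmonic-decay i s))

  geometric-decay : ∀ r → nat (2 ℕ.^ r) * v (r ℕ.* s) ℚ.≤ v 0
  geometric-decay zero    = ℚ.≤-reflexive (ℚ.*-identityˡ (v 0))
  geometric-decay (suc r) = begin
    nat (2 ℕ.* 2 ℕ.^ r) * v (s ℕ.+ r ℕ.* s)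
      ≡⟨ cong (_* v (s ℕ.+ r ℕ.* s)) (trans (nat-* 2 (2 ℕ.^ r)) (ℚ.*-comm (nat 2) (nat (2 ℕ.^ r)))) ⟩
    nat (2 ℕ.^ r) * nat 2 * v (s ℕ.+ r ℕ.* s)
      ≡⟨ ℚ.*-assoc (nat (2 ℕ.^ r)) (nat 2) (v (s ℕ.+ r ℕ.* s)) ⟩
    nat (2 ℕ.^ r) * (nat 2 * v (s ℕ.+ r ℕ.* s))
      ≤⟨ ℚ.*-monoˡ-≤-nonNeg (nat (2 ℕ.^ r)) {{ℚ.nonNegative (0≤nat (2 ℕ.^ r))}} (halving (r ℕ.* s)) ⟩
    nat (2 ℕ.^ r) * v (r ℕ.* s)
      ≤⟨ geometric-decay r ⟩
    v 0 ∎

-- Counted in pairs of steps: a pair removes energy/27 from the variance V, and the Poincaré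
-- inequality bounds the energy below by 2V / (n(n + 1)).
relaxation : ℕ → ℕ
relaxation n = 27 ℕ.* (n ℕ.* suc n)

-- Decay of the variance under the walk

module _ (p q : ℕ) (p-odd : p ≡ suc (q ℕ.+ q)) (k : ℕ) where

  Σ<-moves : ∀ {g} → Periodic p g → Σ< p (moves k g) ≡ nat 3 * Σ< p g
  Σ<-moves {g} per = begin-equality
    Σ< p (λ i → g (i ℕ.+ 1) + g (i ℕ.+ k) + g (2 ℕ.* i))
      ≡⟨ trans (Σ<-+ p (λ i → g (i ℕ.+ 1) + g (i ℕ.+ k)) (λ i → g (2 ℕ.* i)))
           (cong (_+ Σ< p (λ i → g (2 ℕ.* i))) (Σ<-+ p (λ i → g (i ℕ.+ 1)) (λ i → g (i ℕ.+ k)))) ⟩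
    Σ< p (λ i → g (i ℕ.+ 1)) + Σ< p (λ i → g (i ℕ.+ k)) + Σ< p (λ i → g (2 ℕ.* i))
      ≡⟨ cong₂ _+_ (cong₂ _+_ (Σ<-translate per 1) (Σ<-translate per k)) (Σ<-double p q p-odd per) ⟩
    Σ< p g + Σ< p g + Σ< p g
      ≡⟨ solve 1 (λ x → x :+ x :+ x := con (nat 3) :* x) refl (Σ< p g) ⟩
    nat 3 * Σ< p g ∎

  Σ<-walk : ∀ {g} → Periodic p g → ∀ m → Σ< p (walk k m g) ≡ Σ< p g
  Σ<-walk per zero = refl
  Σ<-walk {g} per (suc m) = begin-equality
    Σ< p (λ i → ℤ.+ 1 / 3 * moves k (walk k m g) i)  ≡⟨ Σ<-* p (ℤ.+ 1 / 3) (moves k (walk k m g)) ⟩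
    ℤ.+ 1 / 3 * Σ< p (moves k (walk k m g))          ≡⟨ cong (ℤ.+ 1 / 3 *_) (Σ<-moves (periodic-walk k m per)) ⟩
    ℤ.+ 1 / 3 * (nat 3 * Σ< p (walk k m g))
      ≡⟨ solve 1 (λ x → con (ℤ.+ 1 / 3) :* (con (nat 3) :* x) := x) refl (Σ< p (walk k m g)) ⟩
    Σ< p (walk k m g)                                ≡⟨ Σ<-walk per m ⟩
    Σ< p g                                           ∎

  -- Put i = t + 1 and measure all endpoints from 3: i + 2 = t + 3, 2i + 1 = 2t + 3 and 2(i + 1) =
  -- (2t + 1) + 3.
  Σ<-discrepancy : ∀ {g} → Periodic p g → Σ< p (discrepancy g) ≡ energy p q p-odd (λ t → g (t ℕ.+ 3))
  Σ<-discrepancy {g} per = begin-equality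
    Σ< p (discrepancy g)
      ≡⟨ sym (Σ<-translate per′ 1) ⟩
    Σ< p (λ t → discrepancy g (t ℕ.+ 1))
      ≡⟨ Σ<-cong p (λ t → cong₂ _+_ (reindex₀ t) (reindex₁ t)) ⟩
    Σ< p (λ t → sq (g (2 ℕ.* t ℕ.+ 0 ℕ.+ 3) - g (t ℕ.+ 3)) + sq (g (2 ℕ.* t ℕ.+ 1 ℕ.+ 3) - g (t ℕ.+ 3)))
      ≡⟨ Σ<-+ p (λ t → sq (g (2 ℕ.* t ℕ.+ 0 ℕ.+ 3) - g (t ℕ.+ 3))) (λ t → sq (g (2 ℕ.* t ℕ.+ 1 ℕ.+ 3) - g (t ℕ.+ 3))) ⟩
    energy p q p-odd (λ t → g (t ℕ.+ 3)) ∎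
    where
    per′ : Periodic p (discrepancy g)
    per′ i = cong₂ _+_
      (cong₂ (λ x y → sq (x - y)) (periodic-affine per 2 1 i) (periodic-translate (periodic-translate per 1) 1 i))
      (cong₂ (λ x y → sq (x - y)) (periodic-translate (periodic-double per) 1 i) (periodic-translate (periodic-translate per 1) 1 i))
    third : ∀ t → t ℕ.+ 1 ℕ.+ 1 ℕ.+ 1 ≡ t ℕ.+ 3
    third = solveℕ 1 (λ t → t ⊞ conℕ 1 ⊞ conℕ 1 ⊞ conℕ 1 ≐ t ⊞ conℕ 3) refl
    reindex₀ : ∀ t → sq (g (2 ℕ.* (t ℕ.+ 1) ℕ.+ 1) - g (t ℕ.+ 1 ℕ.+ 1 ℕ.+ 1))
                     ≡ sq (g (2 ℕ.* t ℕ.+ 0 ℕ.+ 3) - g (t ℕ.+ 3))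
    reindex₀ t = cong₂ (λ i j → sq (g i - g j))
      (solveℕ 1 (λ t → conℕ 2 ⊠ (t ⊞ conℕ 1) ⊞ conℕ 1 ≐ conℕ 2 ⊠ t ⊞ conℕ 0 ⊞ conℕ 3) refl t) (third t)
    reindex₁ : ∀ t → sq (g (2 ℕ.* (t ℕ.+ 1 ℕ.+ 1)) - g (t ℕ.+ 1 ℕ.+ 1 ℕ.+ 1))
                     ≡ sq (g (2 ℕ.* t ℕ.+ 1 ℕ.+ 3) - g (t ℕ.+ 3))
    reindex₁ t = cong₂ (λ i j → sq (g i - g j))
      (solveℕ 1 (λ t → conℕ 2 ⊠ (t ⊞ conℕ 1 ⊞ conℕ 1) ≐ conℕ 2 ⊠ t ⊞ conℕ 1 ⊞ conℕ 3) refl t) (third t)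

  step²-energy : ∀ {g} → Periodic p g →
    Σ< p (λ i → sq (step k (step k g) i)) + ℤ.+ 1 / 27 * energy p q p-odd (λ t → g (t ℕ.+ 3))
    ℚ.≤ Σ< p (λ i → sq (g i))
  step²-energy {g} per = begin
    Σ< p (λ i → sq (step k (step k g) i)) + ℤ.+ 1 / 27 * energy p q p-odd (λ t → g (t ℕ.+ 3))
      ≡⟨ cong (λ e → Σ< p (λ i → sq (step k (step k g) i)) + ℤ.+ 1 / 27 * e) (sym (Σ<-discrepancy per)) ⟩
    Σ< p (λ i → sq (step k (step k g) i)) + ℤ.+ 1 / 27 * Σ< p (discrepancy g)
      ≡⟨ sym (trans (Σ<-+ p (λ i → sq (step k (step k g) i)) (λ i → ℤ.+ 1 / 27 * discrepancy g i))
           (cong (Σ< p (λ i → sq (step k (step k g) i)) +_) (Σ<-* p (ℤ.+ 1 / 27) (discrepancy g)))) ⟩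
    Σ< p (λ i → sq (step k (step k g) i) + ℤ.+ 1 / 27 * discrepancy g i)
      ≤⟨ Σ<-mono p (λ i _ → step²-bound k g i) ⟩
    Σ< p (λ i → ℤ.+ 1 / 9 * moves k (moves k g²) i)
      ≡⟨ Σ<-* p (ℤ.+ 1 / 9) (moves k (moves k g²)) ⟩
    ℤ.+ 1 / 9 * Σ< p (moves k (moves k g²))
      ≡⟨ cong (ℤ.+ 1 / 9 *_) (trans (Σ<-moves (periodic-moves k per²)) (cong (nat 3 *_) (Σ<-moves per²))) ⟩
    ℤ.+ 1 / 9 * (nat 3 * (nat 3 * Σ< p g²))
      ≡⟨ solve 1 (λ x → con (ℤ.+ 1 / 9) :* (con (nat 3) :* (con (nat 3) :* x)) := x) refl (Σ< p g²) ⟩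
    Σ< p g² ∎
    where
    g² : ℕ → ℚ
    g² j = sq (g j)
    per² : Periodic p g²
    per² i = cong sq (per i)

  step²-contracts : .{{NonZero p}} → ∀ {g} → Periodic p g → Σ< p g ≡ 0ℚ → ∀ n → p ≤ 2 ℕ.^ n →
    nat (relaxation n) * Σ< p (λ i → sq (step k (step k g) i)) + Σ< p (λ i → sq (g i))
    ℚ.≤ nat (relaxation n) * Σ< p (λ i → sq (g i))
  step²-contracts {g} per mean0 n p≤2^n = begin
    nat (relaxation n) * V″ + V
      ≡⟨ cong (λ r → r * V″ + V) unfold ⟩
    nat 27 * c * V″ + V
      -- Three gains: the energy inequality scaled by 27c, the Poincaré inequality, and one `V`
      -- given away, since the latter supplies `2V` where `V` suffices.
      ≤⟨ ≤-slack (nat 27 * c * (V - (V″ + ℤ.+ 1 / 27 * E)) + (c * E - nat 2 * V) + V)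
           (0≤+ (0≤+ (0≤* (0≤* (0≤nat 27) (0≤* (0≤nat n) (0≤nat (suc n)))) (slack (step²-energy per))) (slack gap))
             (Σ<-nonNeg p (λ i → 0≤sq (g i))))
           (solve 4 (λ c v w e → con (nat 27) :* c :* w :+ v
             :+ (con (nat 27) :* c :* (v :- (w :+ con (ℤ.+ 1 / 27) :* e)) :+ (c :* e :- con (nat 2) :* v) :+ v)
             := con (nat 27) :* c :* v) refl c V V″ E) ⟩
    nat 27 * c * V
      ≡⟨ cong (_* V) (sym unfold) ⟩
    nat (relaxation n) * V ∎
    where
    c = nat n * nat (suc n)
    V = Σ< p (λ i → sq (g i))
    V″ = Σ< p (λ i → sq (step k (step k g) i))
    E = energy p q p-odd (λ t → g (t ℕ.+ 3))
    unfold : nat (relaxation n) ≡ nat 27 * c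
    unfold = trans (nat-* 27 (n ℕ.* suc n)) (cong (nat 27 *_) (nat-* n (suc n)))
    gap : nat 2 * V ℚ.≤ c * E
    gap = subst (λ v → nat 2 * v ℚ.≤ c * E) (Σ<-translate (λ i → cong sq (per i)) 3)
      (poincaré p q p-odd (periodic-translate per 3) (trans (Σ<-translate per 3) mean0) n p≤2^n)

  walk-decay : .{{NonZero p}} → ∀ {g} → Periodic p g → Σ< p g ≡ 0ℚ → ∀ n .{{_ : NonZero (relaxation n)}} →
    p ≤ 2 ℕ.^ n → ∀ r →
    nat (2 ℕ.^ r) * Σ< p (λ i → sq (walk k (r ℕ.* relaxation n ℕ.* 2) g i)) ℚ.≤ Σ< p (λ i → sq (g i))
  -- `suc j * 2` reduces to `2 + j * 2`, so consecutive terms of this sequence differ by two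
  -- applications of `step` definitionally.
  walk-decay {g} per mean0 n p≤2^n = geometric-decay (λ j → Σ< p (λ i → sq (walk k (j ℕ.* 2) g i)))
    (λ j → Σ<-nonNeg p (λ i → 0≤sq (walk k (j ℕ.* 2) g i))) (relaxation n)
    (λ j → step²-contracts (periodic-walk k (j ℕ.* 2) per) (trans (Σ<-walk per (j ℕ.* 2)) mean0) n p≤2^n)

-- The kernel of the walk

nat-unit : ∀ p .{{_ : NonZero p}} → nat p * (ℤ.+ 1 / p) ≡ 1ℚ
nat-unit (suc p) = ℚ.toℚᵘ-injective (ℚᵘ.≃-trans (ℚ.toℚᵘ-homo-* (nat (suc p)) (ℤ.+ 1 / suc p))
  (ℚᵘ.≃-trans (ℚᵘ.*-cong (ℚ.toℚᵘ-fromℚᵘ (ℚᵘ.mkℚᵘ (ℤ.+ suc p) 0)) (ℚ.toℚᵘ-fromℚᵘ (ℚᵘ.mkℚᵘ (ℤ.+ 1) p)))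
    (ℚᵘ.*≡* (trans (ℤ.*-identityʳ (ℤ.+ suc p ℤ.* ℤ.+ 1)) (trans (ℤ.*-comm (ℤ.+ suc p) (ℤ.+ 1))
      (cong (λ n → ℤ.+ 1 ℤ.* ℤ.+ n) (sym (ℕ.*-identityˡ (suc p)))))))))

sum-0 : ∀ {n} {f : Fin n → ℚ} → (∀ z → f z ≡ 0ℚ) → sum f ≡ 0ℚ
sum-0 {n} f≗0 = trans (sum-cong-≗ f≗0) (sum-replicate-zero n)

sum-δ* : ∀ {n} (a : Fin n) h → sum (λ z → δ[ a , z ] * h z) ≡ h a
sum-δ* Fin.zero h = trans (cong₂ _+_ (ℚ.*-identityˡ (h Fin.zero)) (sum-0 λ z → ℚ.*-zeroˡ (h (Fin.suc z))))
  (ℚ.+-identityʳ (h Fin.zero))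
sum-δ* (Fin.suc a) h = trans (cong₂ _+_ (ℚ.*-zeroˡ (h Fin.zero)) (sum-δ* a (λ z → h (Fin.suc z))))
  (ℚ.+-identityˡ (h (Fin.suc a)))

sum-δ : ∀ {n} (y : Fin n) → sum (λ z → δ[ z , y ]) ≡ 1ℚ
sum-δ {suc n} Fin.zero = trans (cong (1ℚ +_) (sum-0 {n} λ _ → refl)) (ℚ.+-identityʳ 1ℚ)
sum-δ (Fin.suc y)      = trans (ℚ.+-identityˡ (sum (λ z → δ[ z , y ]))) (sum-δ y)

Σ<≡sum : ∀ n f → Σ< n f ≡ sum {n} (λ z → f (toℕ z))
Σ<≡sum zero    f = refl
Σ<≡sum (suc n) f = cong (f 0 +_) (Σ<≡sum n (λ i → f (suc i)))

sq-δ : ∀ {n} (x y : Fin n) → sq δ[ x , y ] ≡ δ[ x , y ]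
sq-δ x y with x Fin.≟ y
... | yes _ = refl
... | no  _ = refl

module _ (p : ℕ) .{{_ : NonZero p}} where

  toℕ-mod : ∀ i → toℕ (i ℕ.mod p) ≡ i ℕ.% p
  toℕ-mod i = Fin.toℕ-fromℕ< (ℕ.m%n<n i p)

  mod-cong : ∀ {i j} → i ℕ.% p ≡ j ℕ.% p → i ℕ.mod p ≡ j ℕ.mod p
  mod-cong {i} {j} eq = Fin.toℕ-injective (trans (toℕ-mod i) (trans eq (sym (toℕ-mod j))))

  mod-toℕ : ∀ (z : Fin p) → toℕ z ℕ.mod p ≡ z
  mod-toℕ z = Fin.toℕ-injective (trans (toℕ-mod (toℕ z)) (ℕ.m<n⇒m%n≡m (Fin.toℕ<n z)))

  %-+-absorb : ∀ i c → (i ℕ.% p ℕ.+ c) ℕ.% p ≡ (i ℕ.+ c) ℕ.% p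
  %-+-absorb i c = trans (ℕ.%-distribˡ-+ (i ℕ.% p) c p)
    (trans (cong (λ j → (j ℕ.+ c ℕ.% p) ℕ.% p) (ℕ.m%n%n≡m%n i p)) (sym (ℕ.%-distribˡ-+ i c p)))

  %-*-absorb : ∀ i → (2 ℕ.* (i ℕ.% p)) ℕ.% p ≡ (2 ℕ.* i) ℕ.% p
  %-*-absorb i = trans (ℕ.%-distribˡ-* 2 (i ℕ.% p) p)
    (trans (cong (λ j → (2 ℕ.% p ℕ.* j) ℕ.% p) (ℕ.m%n%n≡m%n i p)) (sym (ℕ.%-distribˡ-* 2 i p)))

  module _ (k y : Fin p) where

    kernel : ℕ → ℕ → ℚ
    kernel m i = (pollardRho p k ^ᴹ m) (i ℕ.mod p) y

    kernel-periodic : Periodic p (kernel 0)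
    kernel-periodic i = cong (λ x → (pollardRho p k ^ᴹ 0) x y) (mod-cong (ℕ.[m+n]%n≡m%n i p))

    pollardRho-apply : ∀ x (h : Fin p → ℚ) → sum (λ z → pollardRho p k x z * h z) ≡
      ℤ.+ 1 / 3 * (h ((toℕ x ℕ.+ 1) ℕ.mod p) + h ((toℕ x ℕ.+ toℕ k) ℕ.mod p) + h ((2 ℕ.* toℕ x) ℕ.mod p))
    pollardRho-apply x h = begin-equality
      sum (λ z → ℤ.+ 1 / 3 * (δ[ a , z ] + δ[ b , z ] + δ[ c , z ]) * h z)
        ≡⟨ sum-cong-≗ (λ z → solve 5 (λ t a b c h → t :* (a :+ b :+ c) :* h
             := a :* (t :* h) :+ b :* (t :* h) :+ c :* (t :* h)) refl
             (ℤ.+ 1 / 3) δ[ a , z ] δ[ b , z ] δ[ c , z ] (h z)) ⟩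
      sum (λ z → δ[ a , z ] * h′ z + δ[ b , z ] * h′ z + δ[ c , z ] * h′ z)
        ≡⟨ trans (∑-distrib-+ (λ z → δ[ a , z ] * h′ z + δ[ b , z ] * h′ z) (λ z → δ[ c , z ] * h′ z))
             (cong (_+ sum (λ z → δ[ c , z ] * h′ z)) (∑-distrib-+ (λ z → δ[ a , z ] * h′ z) (λ z → δ[ b , z ] * h′ z))) ⟩
      sum (λ z → δ[ a , z ] * h′ z) + sum (λ z → δ[ b , z ] * h′ z) + sum (λ z → δ[ c , z ] * h′ z)
        ≡⟨ cong₂ _+_ (cong₂ _+_ (sum-δ* a h′) (sum-δ* b h′)) (sum-δ* c h′) ⟩
      h′ a + h′ b + h′ c
        ≡⟨ solve 4 (λ t a b c → t :* a :+ t :* b :+ t :* c := t :* (a :+ b :+ c)) refl (ℤ.+ 1 / 3) (h a) (h b) (h c) ⟩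
      ℤ.+ 1 / 3 * (h a + h b + h c) ∎
      where
      a = (toℕ x ℕ.+ 1) ℕ.mod p
      b = (toℕ x ℕ.+ toℕ k) ℕ.mod p
      c = (2 ℕ.* toℕ x) ℕ.mod p
      h′ : Fin p → ℚ
      h′ z = ℤ.+ 1 / 3 * h z

    kernel-walk : ∀ m i → kernel m i ≡ walk (toℕ k) m (kernel 0) i
    kernel-walk zero    i = refl
    kernel-walk (suc m) i = trans (pollardRho-apply (i ℕ.mod p) (λ z → (pollardRho p k ^ᴹ m) z y))
      (cong (ℤ.+ 1 / 3 *_) (cong₂ _+_
        (cong₂ _+_
          (at (trans (cong (λ j → (j ℕ.+ 1) ℕ.% p) (toℕ-mod i)) (%-+-absorb i 1)))
          (at (trans (cong (λ j → (j ℕ.+ toℕ k) ℕ.% p) (toℕ-mod i)) (%-+-absorb i (toℕ k)))))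
        (at (trans (cong (λ j → (2 ℕ.* j) ℕ.% p) (toℕ-mod i)) (%-*-absorb i)))))
      where
      at : ∀ {j l} → j ℕ.% p ≡ l ℕ.% p → kernel m j ≡ walk (toℕ k) m (kernel 0) l
      at {j} {l} eq = trans (cong (λ x → (pollardRho p k ^ᴹ m) x y) (mod-cong eq)) (kernel-walk m l)

    private
      u : ℚ
      u = ℤ.+ 1 / p

    Σ<-kernel : Σ< p (kernel 0) ≡ 1ℚ
    Σ<-kernel = trans (Σ<≡sum p (kernel 0))
      (trans (sum-cong-≗ (λ z → cong (λ x → δ[ x , y ]) (mod-toℕ z))) (sum-δ y))

    Σ<-centred : Σ< p (λ i → kernel 0 i - u) ≡ 0ℚ
    Σ<-centred = begin-equality
      Σ< p (λ i → kernel 0 i - u)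
        ≡⟨ Σ<-+ p (kernel 0) (λ _ → - u) ⟩
      Σ< p (kernel 0) + Σ< p (λ _ → - u)
        ≡⟨ cong₂ _+_ Σ<-kernel (trans (Σ<-const p (- u)) (sym (ℚ.neg-distribʳ-* (nat p) u))) ⟩
      1ℚ - nat p * u
        ≡⟨ cong (λ s → 1ℚ - s) (nat-unit p) ⟩
      0ℚ ∎

    -- The exact value is 1 - u: an indicator equals its square, so the sum is 1 - 2u + pu² with pu
    -- = 1.
    variance≤1 : Σ< p (λ i → sq (kernel 0 i - u)) ℚ.≤ 1ℚ
    variance≤1 = ≤-slack u (ℚ.nonNegative⁻¹ u {{ℚ.normalize-nonNeg 1 p}}) (begin-equality
      Σ< p (λ i → sq (kernel 0 i - u)) + u
        ≡⟨ cong (_+ u) (Σ<-cong p (λ i → trans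
             (solve 2 (λ d u → (d :- u) :* (d :- u) := (d :* d :+ con (- nat 2) :* u :* d) :+ u :* u) refl (kernel 0 i) u)
             (cong (λ s → s + - nat 2 * u * kernel 0 i + u * u) (sq-δ (i ℕ.mod p) y)))) ⟩
      Σ< p (λ i → kernel 0 i + - nat 2 * u * kernel 0 i + u * u) + u
        ≡⟨ cong (_+ u) (trans (Σ<-+ p (λ i → kernel 0 i + - nat 2 * u * kernel 0 i) (λ _ → u * u))
             (cong₂ _+_ (Σ<-+ p (kernel 0) (λ i → - nat 2 * u * kernel 0 i)) (Σ<-const p (u * u)))) ⟩
      Σ< p (kernel 0) + Σ< p (λ i → - nat 2 * u * kernel 0 i) + nat p * (u * u) + u
        ≡⟨ cong₂ (λ s t → s + t + nat p * (u * u) + u) Σ<-kernel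
             (trans (Σ<-* p (- nat 2 * u) (kernel 0)) (cong (- nat 2 * u *_) Σ<-kernel)) ⟩
      1ℚ + - nat 2 * u * 1ℚ + nat p * (u * u) + u
        ≡⟨ solve 2 (λ p u → con 1ℚ :+ con (- nat 2) :* u :* con 1ℚ :+ p :* (u :* u) :+ u
             := con 1ℚ :- u :+ (p :* u) :* u) refl (nat p) u ⟩
      1ℚ - u + nat p * u * u
        ≡⟨ cong (λ s → 1ℚ - u + s * u) (nat-unit p) ⟩
      1ℚ - u + 1ℚ * u
        ≡⟨ solve 1 (λ u → con 1ℚ :- u :+ con 1ℚ :* u := con 1ℚ) refl u ⟩
      1ℚ ∎)

  inv-uniform : inv (ℤ.+ 1 / p) ≡ nat p
  inv-uniform = begin-equality
    inv u              ≡⟨ sym (ℚ.*-identityˡ (inv u)) ⟩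
    1ℚ * inv u         ≡⟨ cong (_* inv u) (sym (nat-unit p)) ⟩
    nat p * u * inv u  ≡⟨ ℚ.*-assoc (nat p) u (inv u) ⟩
    nat p * (u * inv u) ≡⟨ cong (nat p *_) (inv-inverse u (>⇒≢0 (ℚ.positive⁻¹ u {{ℚ.normalize-pos 1 p}}))) ⟩
    nat p * 1ℚ         ≡⟨ ℚ.*-identityʳ (nat p) ⟩
    nat p              ∎
    where
    u = ℤ.+ 1 / p

-- From variance to separation distance

sq≤1⇒-≤1 : ∀ {a} → sq a ℚ.≤ 1ℚ → - a ℚ.≤ 1ℚ
-- The certificate is 1 + a = ½((1 + a)² + (1 - a²)).
sq≤1⇒-≤1 {a} sq≤1 = ≤-slack (ℚ.½ * (sq (1ℚ + a) + (1ℚ - sq a)))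
  (0≤* (ℚ.nonNegative⁻¹ ℚ.½) (0≤+ (0≤sq (1ℚ + a)) (slack sq≤1)))
  (solve 1 (λ a → :- a :+ con ℚ.½ :* ((con 1ℚ :+ a) :* (con 1ℚ :+ a) :+ (con 1ℚ :- a :* a)) := con 1ℚ) refl a)

-- Applied with `f` the deviation from 1/p, `c` = p and `T` a power of 2. Separation is one-sided: a
-- nonnegative `f` is harmless, and for a negative one the bound 1/T on its size is enough.
deficit-bound : ∀ {f T e c} → 0ℚ ℚ.≤ e → 0ℚ ℚ.≤ c → c ℚ.≤ e * T → sq (T * f) ℚ.≤ 1ℚ → - (f * c) ℚ.≤ e
deficit-bound {f} {T} {e} {c} 0≤e 0≤c c≤eT small with ℚ.≤-total 0ℚ f
... | inj₁ 0≤f = ℚ.≤-trans (ℚ.neg-antimono-≤ (0≤* 0≤f 0≤c)) 0≤e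
... | inj₂ f≤0 = begin
  - (f * c)         ≡⟨ ℚ.neg-distribˡ-* f c ⟩
  - f * c           ≤⟨ ℚ.*-monoˡ-≤-nonNeg (- f) {{ℚ.nonNegative (ℚ.neg-antimono-≤ f≤0)}} c≤eT ⟩
  - f * (e * T)     ≡⟨ solve 3 (λ f e t → :- f :* (e :* t) := e :* :- (t :* f)) refl f e T ⟩
  e * - (T * f)     ≤⟨ ℚ.*-monoˡ-≤-nonNeg e {{ℚ.nonNegative 0≤e}} (sq≤1⇒-≤1 small) ⟩
  e * 1ℚ            ≡⟨ ℚ.*-identityʳ e ⟩
  e                 ∎

-- The `t + t` halvings divide the variance by 4^t, hence bound each deviation by 2^(-t). The factor
-- 2 at the end converts pairs of steps into steps.
mixing-steps : ℕ → ℕ → ℕ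
mixing-steps n t = (t ℕ.+ t) ℕ.* relaxation n ℕ.* 2

separation-bound : ∀ p .{{_ : NonZero p}} q → p ≡ suc (q ℕ.+ q) → ∀ k n .{{_ : NonZero (relaxation n)}} → p ≤ 2 ℕ.^ n →
  ∀ t e → 0ℚ ℚ.≤ e → nat p ℚ.≤ e * nat (2 ℕ.^ t) → ∀ x y →
  1ℚ - (pollardRho p k ^ᴹ mixing-steps n t) x y * inv (uniform p x) ℚ.≤ e
separation-bound p q p-odd k n p≤2^n t e 0≤e p≤eT x y = begin
  1ℚ - (pollardRho p k ^ᴹ m) x y * inv u
    ≡⟨ cong₂ (λ w c → 1ℚ - w * c)
         (trans (cong (λ z → (pollardRho p k ^ᴹ m) z y) (sym (mod-toℕ p x))) (kernel-walk p k y m i)) (inv-uniform p) ⟩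
  1ℚ - w * nat p
    ≡⟨ cong (_- w * nat p) (sym (nat-unit p)) ⟩
  nat p * u - w * nat p
    ≡⟨ solve 3 (λ p u w → p :* u :- w :* p := :- ((w :- u) :* p)) refl (nat p) u w ⟩
  - ((w - u) * nat p)
    ≤⟨ deficit-bound {w - u} {nat (2 ℕ.^ t)} 0≤e (0≤nat p) p≤eT small ⟩
  e ∎
  where
  m = mixing-steps n t
  i = toℕ x
  u = ℤ.+ 1 / p
  w = walk (toℕ k) m (kernel p k y 0) i
  T = nat (2 ℕ.^ t)
  g : ℕ → ℚ
  g j = kernel p k y 0 j - u
  small : sq (T * (w - u)) ℚ.≤ 1ℚ
  small = begin
    sq (T * (w - u))
      ≡⟨ solve 2 (λ t f → t :* f :* (t :* f) := t :* t :* (f :* f)) refl T (w - u) ⟩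
    T * T * sq (w - u)
      ≡⟨ cong₂ (λ s f → s * sq f) (trans (sym (nat-* (2 ℕ.^ t) (2 ℕ.^ t))) (cong nat (sym (ℕ.^-distribˡ-+-* 2 t t))))
           (sym (walk-− (toℕ k) m (kernel p k y 0) u i)) ⟩
    nat (2 ℕ.^ (t ℕ.+ t)) * sq (walk (toℕ k) m g i)
      -- From ℓ² to the pointwise bound: a single squared deviation is at most the sum of all of
      -- them.
      ≤⟨ ℚ.*-monoˡ-≤-nonNeg (nat (2 ℕ.^ (t ℕ.+ t))) {{ℚ.nonNegative (0≤nat (2 ℕ.^ (t ℕ.+ t)))}}
           (term≤Σ< p (λ j → 0≤sq (walk (toℕ k) m g j)) i (Fin.toℕ<n x)) ⟩
    nat (2 ℕ.^ (t ℕ.+ t)) * Σ< p (λ j → sq (walk (toℕ k) m g j))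
      ≤⟨ walk-decay p q p-odd (toℕ k) (λ j → cong (_- u) (kernel-periodic p k y j)) (Σ<-centred p k y) n p≤2^n (t ℕ.+ t) ⟩
    Σ< p (λ j → sq (g j))
      ≤⟨ variance≤1 p k y ⟩
    1ℚ ∎

-- Lower bounds for the logarithm

module _ (z : ℝ) (n : ℕ) (0≤w : 0ℚ ℚ.≤ seq z n) (w≤1 : seq z n ℚ.≤ 1ℚ) where

  private
    w : ℚ
    w = seq z n
    power : ℕ → ℚ
    power i = seq (z ^ℝ i) n
    A : ℕ → ℚ
    A j = seq (artanhSum j z) n
    odd : ℕ → ℕ
    odd j = suc (j ℕ.+ j)
    c : ℕ → ℚ
    c j = ℤ.+ 1 / odd j

  power-nonNeg : ∀ i → 0ℚ ℚ.≤ power i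
  power-nonNeg zero    = ℚ.<⇒≤ 0<1
  power-nonNeg (suc i) = 0≤* 0≤w (power-nonNeg i)

  power-bernoulli : ∀ i → 1ℚ - nat i * (1ℚ - w) ℚ.≤ power i
  power-bernoulli zero    = ℚ.≤-reflexive (solve 1 (λ w → con 1ℚ :- con 0ℚ :* (con 1ℚ :- w) := con 1ℚ) refl w)
  power-bernoulli (suc i) = ≤-slack (w * (power i - (1ℚ - nat i * (1ℚ - w))) + nat i * sq (1ℚ - w))
    (0≤+ (0≤* 0≤w (slack (power-bernoulli i))) (0≤* (0≤nat i) (0≤sq (1ℚ - w))))
    (trans (cong (λ k → 1ℚ - k * (1ℚ - w) + (w * (power i - (1ℚ - nat i * (1ℚ - w))) + nat i * sq (1ℚ - w))) (nat-suc i))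
      (solve 3 (λ w i p → con 1ℚ :- (con 1ℚ :+ i) :* (con 1ℚ :- w)
        :+ (w :* (p :- (con 1ℚ :- i :* (con 1ℚ :- w))) :+ i :* ((con 1ℚ :- w) :* (con 1ℚ :- w)))
        := w :* p) refl w (nat i) (power i)))

  coefficient-nonNeg : ∀ j → 0ℚ ℚ.≤ c j
  coefficient-nonNeg j = ℚ.nonNegative⁻¹ (c j) {{ℚ.normalize-nonNeg 1 (odd j)}}

  artanhSum-suc : ∀ j → A j ℚ.≤ A (suc j)
  artanhSum-suc j = ≤-+ʳ (A j) (0≤* (coefficient-nonNeg j) (power-nonNeg (odd j)))

  artanhSum-mono : ∀ {j l} → j ≤ l → A j ℚ.≤ A l
  artanhSum-mono {j} {l} j≤l = subst (λ i → A j ℚ.≤ A i) (ℕ.m∸n+n≡m j≤l) (go (l ℕ.∸ j))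
    where
    go : ∀ i → A j ℚ.≤ A (i ℕ.+ j)
    go zero    = ℚ.≤-refl
    go (suc i) = ℚ.≤-trans (go i) (artanhSum-suc (i ℕ.+ j))

  module _ (M : ℕ) .{{_ : NonZero M}} (near-1 : nat (8 ℕ.* M) * (1ℚ - w) ℚ.≤ 1ℚ) where

    -- As 2j + 1 ≤ 4M, the coefficient is at least 1/(4M), and Bernoulli's inequality keeps the
    -- power above 1 - 4M(1 - w) ≥ 1/2.
    term-bound : ∀ j → j ℕ.< M ℕ.+ M → 1ℚ ℚ.≤ nat (8 ℕ.* M) * (c j * power (odd j))
    term-bound j j<2M = begin
      1ℚ * 1ℚ
        ≤⟨ *-mono-≤⁺ (ℚ.≤-trans (ℚ.<⇒≤ 0<1) 4Mc) (ℚ.<⇒≤ 0<1) 4Mc 2w ⟩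
      nat (4 ℕ.* M) * c j * (nat 2 * power (odd j))
        ≡⟨ solve 4 (λ t m c w → m :* c :* (t :* w) := t :* m :* (c :* w)) refl (nat 2) (nat (4 ℕ.* M)) (c j) (power (odd j)) ⟩
      nat 2 * nat (4 ℕ.* M) * (c j * power (odd j))
        ≡⟨ cong (_* (c j * power (odd j))) (sym 8M) ⟩
      nat (8 ℕ.* M) * (c j * power (odd j)) ∎
      where
      8M : nat (8 ℕ.* M) ≡ nat 2 * nat (4 ℕ.* M)
      8M = trans (cong nat (ℕ.*-assoc 2 4 M)) (nat-* 2 (4 ℕ.* M))
      odd≤4M : odd j ≤ 4 ℕ.* M
      odd≤4M = ℕ.≤-trans (ℕ.≤-trans (ℕ.n≤1+n (odd j)) (ℕ.≤-reflexive (cong suc (sym (ℕ.+-suc j j)))))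
        (ℕ.≤-trans (ℕ.+-mono-≤ j<2M j<2M) (ℕ.≤-reflexive (solveℕ 1 (λ M → M ⊞ M ⊞ (M ⊞ M) ≐ conℕ 4 ⊠ M) refl M)))
      4Mc : 1ℚ ℚ.≤ nat (4 ℕ.* M) * c j
      4Mc = subst (ℚ._≤ nat (4 ℕ.* M) * c j) (nat-unit (odd j))
        (ℚ.*-monoʳ-≤-nonNeg (c j) {{ℚ.nonNegative (coefficient-nonNeg j)}} (nat-mono odd≤4M))
      2w : 1ℚ ℚ.≤ nat 2 * power (odd j)
      2w = ≤-slack (nat 2 * (power (odd j) - (1ℚ - o * (1ℚ - w))) + nat 2 * ((m - o) * (1ℚ - w)) + (1ℚ - nat 2 * m * (1ℚ - w)))
        (0≤+ (0≤+ (0≤* (0≤nat 2) (slack (power-bernoulli (odd j))))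
          (0≤* (0≤nat 2) (0≤* (slack (nat-mono odd≤4M)) (slack w≤1))))
          (slack (subst (λ s → s * (1ℚ - w) ℚ.≤ 1ℚ) 8M near-1)))
        (solve 4 (λ o m w p → con 1ℚ :+ (con (nat 2) :* (p :- (con 1ℚ :- o :* (con 1ℚ :- w)))
          :+ con (nat 2) :* ((m :- o) :* (con 1ℚ :- w)) :+ (con 1ℚ :- con (nat 2) :* m :* (con 1ℚ :- w)))
          := con (nat 2) :* p) refl o m w (power (odd j)))
        where
        o = nat (odd j)
        m = nat (4 ℕ.* M)

    partial-block : ∀ l → l ≤ M → nat (8 ℕ.* M) * A M + nat l ℚ.≤ nat (8 ℕ.* M) * A (l ℕ.+ M)
    partial-block zero    _   = ℚ.≤-reflexive (ℚ.+-identityʳ (nat (8 ℕ.* M) * A M))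
    partial-block (suc l) l<M = begin
      E * A M + nat (suc l)
        ≡⟨ cong (E * A M +_) (nat-suc l) ⟩
      E * A M + (1ℚ + nat l)
        ≡⟨ solve 2 (λ a l → a :+ (con 1ℚ :+ l) := (a :+ l) :+ con 1ℚ) refl (E * A M) (nat l) ⟩
      E * A M + nat l + 1ℚ
        ≤⟨ ℚ.+-mono-≤ (partial-block l (ℕ.<⇒≤ l<M)) (term-bound (l ℕ.+ M) (ℕ.+-monoˡ-< M l<M)) ⟩
      E * A (l ℕ.+ M) + E * (c (l ℕ.+ M) * power (odd (l ℕ.+ M)))
        ≡⟨ sym (ℚ.*-distribˡ-+ E (A (l ℕ.+ M)) (c (l ℕ.+ M) * power (odd (l ℕ.+ M)))) ⟩
      E * A (suc l ℕ.+ M) ∎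
      where
      E = nat (8 ℕ.* M)

    dyadic-block : nat 8 * A M + 1ℚ ℚ.≤ nat 8 * A (M ℕ.+ M)
    dyadic-block = ℚ.*-cancelˡ-≤-pos (nat M) {{ℚ.positive (0<nat M)}} (begin
      nat M * (nat 8 * A M + 1ℚ)
        ≡⟨ solve 3 (λ e m a → m :* (e :* a :+ con 1ℚ) := e :* m :* a :+ m) refl (nat 8) (nat M) (A M) ⟩
      nat 8 * nat M * A M + nat M
        ≡⟨ cong (λ s → s * A M + nat M) (sym (nat-* 8 M)) ⟩
      nat (8 ℕ.* M) * A M + nat M
        ≤⟨ partial-block M ℕ.≤-refl ⟩
      nat (8 ℕ.* M) * A (M ℕ.+ M)
        ≡⟨ trans (cong (_* A (M ℕ.+ M)) (nat-* 8 M))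
             (solve 3 (λ e m a → e :* m :* a := m :* (e :* a)) refl (nat 8) (nat M) (A (M ℕ.+ M))) ⟩
      nat M * (nat 8 * A (M ℕ.+ M)) ∎)

  -- The terms z^(2j+1)/(2j+1) with M ≤ j < 2M are at least (1/2)/(4M) each as long as
  -- 8M (1 - z) ≤ 1, so every dyadic block contributes 1/8.
  artanhSum-lower : 1ℚ ℚ.≤ nat 3 * w → ∀ i → i ≡ 0 ⊎ nat (2 ℕ.^ (2 ℕ.+ i)) * (1ℚ - w) ℚ.≤ 1ℚ →
    nat (suc i) ℚ.≤ nat 8 * A (2 ℕ.^ i)
  artanhSum-lower third zero _ = begin
    1ℚ                             ≤⟨ third ⟩
    nat 3 * w                      ≤⟨ ≤-slack (nat 5 * w) (0≤* (0≤nat 5) 0≤w)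
                                        (solve 1 (λ w → con (nat 3) :* w :+ con (nat 5) :* w
                                          := con (nat 8) :* (con 0ℚ :+ con 1ℚ :* (w :* con 1ℚ))) refl w) ⟩
    nat 8 * (0ℚ + 1ℚ * (w * 1ℚ))   ∎
  artanhSum-lower third (suc i) (inj₂ near) = begin
    nat (suc (suc i))              ≡⟨ trans (nat-suc (suc i)) (ℚ.+-comm 1ℚ (nat (suc i))) ⟩
    nat (suc i) + 1ℚ               ≤⟨ ℚ.+-monoˡ-≤ 1ℚ (artanhSum-lower third i (inj₂ near′)) ⟩
    nat 8 * A (2 ℕ.^ i) + 1ℚ       ≤⟨ dyadic-block (2 ℕ.^ i) {{ℕ.m^n≢0 2 i}} near″ ⟩
    nat 8 * A (2 ℕ.^ i ℕ.+ 2 ℕ.^ i) ≡⟨ cong (λ j → nat 8 * A (2 ℕ.^ i ℕ.+ j)) (sym (ℕ.+-identityʳ (2 ℕ.^ i))) ⟩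
    nat 8 * A (2 ℕ.^ suc i)        ∎
    where
    near′ : nat (2 ℕ.^ (2 ℕ.+ i)) * (1ℚ - w) ℚ.≤ 1ℚ
    near′ = ℚ.≤-trans (ℚ.*-monoʳ-≤-nonNeg (1ℚ - w) {{ℚ.nonNegative (slack w≤1)}}
      (nat-mono (ℕ.^-monoʳ-≤ 2 (ℕ.+-monoʳ-≤ 2 (ℕ.n≤1+n i))))) near
    near″ : nat (8 ℕ.* 2 ℕ.^ i) * (1ℚ - w) ℚ.≤ 1ℚ
    near″ = subst (λ e → nat e * (1ℚ - w) ℚ.≤ 1ℚ) (ℕ.^-distribˡ-+-* 2 3 i) near

module _ {X : ℚ} (2≤X : nat 2 ℚ.≤ X) where

  private
    w v : ℚ
    v = inv (X + 1ℚ)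
    w = (X - 1ℚ) * v

    0<X+1 : 0ℚ ℚ.< X + 1ℚ
    0<X+1 = 0<+ (ℚ.<-≤-trans (0<nat 2) 2≤X) 0<1

    0≤v : 0ℚ ℚ.≤ v
    0≤v = ℚ.<⇒≤ (inv-pos 0<X+1)

    v-inverse : (X + 1ℚ) * v ≡ 1ℚ
    v-inverse = inv-inverse (X + 1ℚ) (>⇒≢0 0<X+1)

  1-cayley : 1ℚ - w ≡ nat 2 * v
  1-cayley = trans (cong (_- w) (sym v-inverse))
    (solve 2 (λ X v → (X :+ con 1ℚ) :* v :- (X :- con 1ℚ) :* v := con (nat 2) :* v) refl X v)

  cayley≤1 : w ℚ.≤ 1ℚ
  cayley≤1 = ≤-slack (nat 2 * v) (0≤* (0≤nat 2) 0≤v)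
    (trans (cong (w +_) (sym 1-cayley)) (solve 1 (λ w → w :+ (con 1ℚ :- w) := con 1ℚ) refl w))

  0≤cayley : 0ℚ ℚ.≤ w
  0≤cayley = 0≤* (≤-slack (X - nat 2 + 1ℚ) (0≤+ (slack 2≤X) (ℚ.<⇒≤ 0<1))
    (solve 1 (λ X → con 0ℚ :+ (X :- con (nat 2) :+ con 1ℚ) := X :- con 1ℚ) refl X)) 0≤v

  third≤cayley : 1ℚ ℚ.≤ nat 3 * w
  third≤cayley = ≤-slack (nat 2 * (X - nat 2) * v) (0≤* (0≤* (0≤nat 2) (slack 2≤X)) 0≤v)
    (trans (cong (_+ nat 2 * (X - nat 2) * v) (sym v-inverse))
      (solve 2 (λ X v → (X :+ con 1ℚ) :* v :+ con (nat 2) :* (X :- con (nat 2)) :* v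
        := con (nat 3) :* ((X :- con 1ℚ) :* v)) refl X v))

  cayley-near-1 : ∀ i → nat (2 ℕ.^ (3 ℕ.+ i)) ℚ.≤ X → nat (2 ℕ.^ (2 ℕ.+ i)) * (1ℚ - w) ℚ.≤ 1ℚ
  cayley-near-1 i le = begin
    a * (1ℚ - w)      ≡⟨ cong (a *_) 1-cayley ⟩
    a * (nat 2 * v)   ≡⟨ solve 3 (λ a t v → a :* (t :* v) := t :* a :* v) refl a (nat 2) v ⟩
    nat 2 * a * v     ≡⟨ cong (_* v) (sym (nat-* 2 (2 ℕ.^ (2 ℕ.+ i)))) ⟩
    nat (2 ℕ.^ (3 ℕ.+ i)) * v ≤⟨ ℚ.*-monoʳ-≤-nonNeg v {{ℚ.nonNegative 0≤v}} (ℚ.≤-trans le (≤-+ʳ X (ℚ.<⇒≤ 0<1))) ⟩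
    (X + 1ℚ) * v      ≡⟨ v-inverse ⟩
    1ℚ                ∎
    where
    a = nat (2 ℕ.^ (2 ℕ.+ i))

-- The n-th term of `log` is twice a partial sum of length n at the n-th term of the Cayley
-- transform. From n = 2^i on, it dominates the partial sum of length 2^i, whose terms are
-- nonnegative; that one is at least (i + 1)/8, so 1/4 = 2/8. For i = 0 the first summand alone
-- suffices, by X ≥ 2.
log-lower : ∀ x (0<x : 0ℝ <ℝ x) i →
  Eventually (λ n → nat 2 ℚ.≤ seq x n × (i ≡ 0 ⊎ nat (2 ℕ.^ (3 ℕ.+ i)) ℚ.≤ seq x n)) →
  Eventually (λ n → nat (suc i) * (ℤ.+ 1 / 4) ℚ.≤ seq (log x 0<x) n)
log-lower x 0<x i (N , large) = N ℕ.⊔ 2 ℕ.^ i , λ n le →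
  let 2≤X , cond = large n (ℕ.≤-trans (ℕ.m≤m⊔n N (2 ℕ.^ i)) le)
  in bound n 2≤X cond (ℕ.≤-trans (ℕ.m≤n⊔m N (2 ℕ.^ i)) le)
  where
  z = cayley x 0<x
  bound : ∀ n → nat 2 ℚ.≤ seq x n → i ≡ 0 ⊎ nat (2 ℕ.^ (3 ℕ.+ i)) ℚ.≤ seq x n → 2 ℕ.^ i ≤ n →
    nat (suc i) * (ℤ.+ 1 / 4) ℚ.≤ nat 2 * seq (artanhSum n z) n
  bound n 2≤X cond 2^i≤n = begin
    nat (suc i) * (ℤ.+ 1 / 4)
      ≤⟨ ℚ.*-monoʳ-≤-nonNeg (ℤ.+ 1 / 4) (artanhSum-lower z n (0≤cayley 2≤X) (cayley≤1 2≤X) (third≤cayley 2≤X) i (near cond)) ⟩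
    nat 8 * seq (artanhSum (2 ℕ.^ i) z) n * (ℤ.+ 1 / 4)
      ≡⟨ solve 1 (λ a → con (nat 8) :* a :* con (ℤ.+ 1 / 4) := con (nat 2) :* a) refl (seq (artanhSum (2 ℕ.^ i) z) n) ⟩
    nat 2 * seq (artanhSum (2 ℕ.^ i) z) n
      ≤⟨ ℚ.*-monoˡ-≤-nonNeg (nat 2) (artanhSum-mono z n (0≤cayley 2≤X) (cayley≤1 2≤X) 2^i≤n) ⟩
    nat 2 * seq (artanhSum n z) n ∎
    where
    near : i ≡ 0 ⊎ nat (2 ℕ.^ (3 ℕ.+ i)) ℚ.≤ seq x n → i ≡ 0 ⊎ nat (2 ℕ.^ (2 ℕ.+ i)) * (1ℚ - seq z n) ℚ.≤ 1ℚ
    near (inj₁ i≡0) = inj₁ i≡0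
    near (inj₂ le)  = inj₂ (cayley-near-1 2≤X i le)

-- Dyadic scales and rational approximation of ε

n≤2^n : ∀ n → n ≤ 2 ℕ.^ n
n≤2^n zero    = ℕ.z≤n
n≤2^n (suc n) = ℕ.≤-trans (ℕ.+-mono-≤ (ℕ.m^n>0 2 n) (n≤2^n n))
  (ℕ.+-monoʳ-≤ (2 ℕ.^ n) (ℕ.≤-reflexive (sym (ℕ.+-identityʳ (2 ℕ.^ n)))))

-- The search descends from an archimedean bound, keeping the upper estimate, until the lower one
-- holds or i = 0. The upper estimate fixes the number of digits or halvings, the lower one feeds
-- `log-lower`; its exponent 4 + i exceeds the 3 + i required there by one, which pays for replacing
-- ε by `e`.
dyadic-scale : ∀ y → ∃[ i ] (y ℚ.≤ nat (2 ℕ.^ (5 ℕ.+ i)) × (i ≡ 0 ⊎ nat (2 ℕ.^ (4 ℕ.+ i)) ℚ.≤ y))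
dyadic-scale y =
  let M , y≤M = archimedean y
  in search M (ℚ.≤-trans (subst (y ℚ.≤_) (sym (nat≡ι M)) y≤M)
       (nat-mono (ℕ.≤-trans (n≤2^n M) (ℕ.^-monoʳ-≤ 2 (ℕ.m≤n+m M 5)))))
  where
  search : ∀ M → y ℚ.≤ nat (2 ℕ.^ (5 ℕ.+ M)) →
    ∃[ i ] (y ℚ.≤ nat (2 ℕ.^ (5 ℕ.+ i)) × (i ≡ 0 ⊎ nat (2 ℕ.^ (4 ℕ.+ i)) ℚ.≤ y))
  search zero    le = 0 , le , inj₁ refl
  search (suc M) le = decide (nat (2 ℕ.^ (4 ℕ.+ suc M)) ℚ.≤? y)
    where
    decide : Dec (nat (2 ℕ.^ (4 ℕ.+ suc M)) ℚ.≤ y) → _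
    decide (yes large) = suc M , le , inj₂ large
    decide (no  small) = search M (subst (λ e → y ℚ.≤ nat (2 ℕ.^ e)) (ℕ.+-suc 4 M) (ℚ.<⇒≤ (ℚ.≰⇒> small)))

odd⇒≡ : ∀ p → ¬ 2 ∣ p → p ≡ suc (p ℕ./ 2 ℕ.+ p ℕ./ 2)
odd⇒≡ p ¬2∣p with p ℕ.% 2 in eq | ℕ.m%n<n p 2
... | 0 | _ = contradiction (m%n≡0⇒n∣m p 2 eq) ¬2∣p
... | 1 | _ = trans (ℕ.m≡m%n+[m/n]*n p 2) (cong₂ ℕ._+_ eq
  (trans (ℕ.*-comm (p ℕ./ 2) 2) (cong (p ℕ./ 2 ℕ.+_) (ℕ.+-identityʳ (p ℕ./ 2)))))
... | suc (suc _) | ℕ.s≤s (ℕ.s≤s ())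

-- 19440 is the value of the left side at i = j = 0. The difference of the two polynomials is then
-- `108 * rest`, with no negative coefficient.
mixing-steps-bound : ∀ i j → mixing-steps (5 ℕ.+ i) (6 ℕ.+ j) ≤ 19440 ℕ.* (suc i ℕ.* suc i ℕ.* suc j)
mixing-steps-bound i j = subst (mixing-steps (5 ℕ.+ i) (6 ℕ.+ j) ≤_)
  (solveℕ 2 (λ i j →
    (conℕ 6 ⊞ j ⊞ (conℕ 6 ⊞ j)) ⊠ (conℕ 27 ⊠ ((conℕ 5 ⊞ i) ⊠ (conℕ 6 ⊞ i))) ⊠ conℕ 2
      ⊞ conℕ 108 ⊠ (conℕ 294 ⊠ i ⊞ conℕ 174 ⊠ (i ⊠ i) ⊞ conℕ 150 ⊠ j ⊞ conℕ 349 ⊠ (i ⊠ j) ⊞ conℕ 179 ⊠ (i ⊠ i ⊠ j))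
    ≐ conℕ 19440 ⊠ ((conℕ 1 ⊞ i) ⊠ (conℕ 1 ⊞ i) ⊠ (conℕ 1 ⊞ j))) refl i j)
  (ℕ.m≤m+n (mixing-steps (5 ℕ.+ i) (6 ℕ.+ j)) (108 ℕ.* rest))
  where
  rest : ℕ
  rest = 294 ℕ.* i ℕ.+ 174 ℕ.* (i ℕ.* i) ℕ.+ 150 ℕ.* j ℕ.+ 349 ℕ.* (i ℕ.* j) ℕ.+ 179 ℕ.* (i ℕ.* i ℕ.* j)

inv-doubling : ∀ {a b} → 0ℚ ℚ.< a → 0ℚ ℚ.< b → b ℚ.≤ nat 2 * a → inv a ℚ.≤ nat 2 * inv b
inv-doubling {a} {b} 0<a 0<b b≤2a = begin
  inv a                      ≡⟨ sym (ℚ.*-identityʳ (inv a)) ⟩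
  inv a * 1ℚ                 ≡⟨ cong (inv a *_) (sym (inv-inverse b (>⇒≢0 0<b))) ⟩
  inv a * (b * inv b)        ≤⟨ ℚ.*-monoˡ-≤-nonNeg (inv a) {{ℚ.nonNegative (ℚ.<⇒≤ (inv-pos 0<a))}}
                                  (ℚ.*-monoʳ-≤-nonNeg (inv b) {{ℚ.nonNegative (ℚ.<⇒≤ (inv-pos 0<b))}} b≤2a) ⟩
  inv a * (nat 2 * a * inv b) ≡⟨ solve 4 (λ t a i j → i :* (t :* a :* j) := t :* ((a :* i) :* j)) refl (nat 2) a (inv a) (inv b) ⟩
  nat 2 * (a * inv a * inv b) ≡⟨ cong (λ s → nat 2 * (s * inv b)) (inv-inverse a (>⇒≢0 0<a)) ⟩
  nat 2 * (1ℚ * inv b)       ≡⟨ cong (nat 2 *_) (ℚ.*-identityˡ (inv b)) ⟩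
  nat 2 * inv b              ∎

-- `x` stands for a term of the sequence of ε and `e` for its fixed rational substitute.
record Near (e x : ℚ) : Set where
  field
    0<x  : 0ℚ ℚ.< x
    x≤1  : x ℚ.≤ 1ℚ
    e≤2x : e ℚ.≤ nat 2 * x
    x≤2e : x ℚ.≤ nat 2 * e

-- The Cauchy precision is `c`, a positive lower bound for the late terms: an error of at most `c`
-- at most doubles any of them.
approximate : ∀ ε → 0ℝ <ℝ ε → ε <ℝ 1ℝ → ∃[ e ] (0ℚ ℚ.< e × Eventually λ n → Near e (seq ε n))
approximate ε 0<ε (d , 0<d , L , ε+d≤1) =
  let c , 0<c , K , c≤ε = positive-bound ε 0<ε
      N , close = cauchy ε c 0<c
      M = K ℕ.⊔ N
      e = seq ε M
      c≤e = c≤ε M (ℕ.m≤m⊔n K N)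
      N≤M = ℕ.m≤n⊔m K N
      within : ∀ {a b} → c ℚ.≤ b → ℚ.∣ a - b ∣ ℚ.≤ c → a ℚ.≤ nat 2 * b
      within {a} {b} c≤b le = ≤-slack ((c - (a - b)) + (b - c))
        (0≤+ (slack (ℚ.≤-trans (p≤∣p∣ (a - b)) le)) (slack c≤b))
        (solve 3 (λ a b c → a :+ ((c :- (a :- b)) :+ (b :- c)) := con (nat 2) :* b) refl a b c)
  in e , ℚ.<-≤-trans 0<c c≤e , M ℕ.⊔ L , λ n le →
    let M≤n = ℕ.≤-trans (ℕ.m≤m⊔n M L) le
        L≤n = ℕ.≤-trans (ℕ.m≤n⊔m M L) le
        N≤n = ℕ.≤-trans N≤M M≤n
        c≤x = c≤ε n (ℕ.≤-trans (ℕ.m≤m⊔n K N) M≤n)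
    in record
      { 0<x  = ℚ.<-≤-trans 0<c c≤x
      ; x≤1  = ℚ.≤-trans (≤-+ʳ (seq ε n) (ℚ.<⇒≤ 0<d)) (ε+d≤1 n L≤n)
      ; e≤2x = within c≤x (close M n N≤M N≤n)
      ; x≤2e = within c≤e (close n M N≤n N≤M)
      }

-- The comparison of `e` with `x` costs one more power of 2, whence 6 + j instead of 5 + j in
-- `steps`.
scale-bound : ∀ {P e x} j → 0ℚ ℚ.< e → P * inv e ℚ.≤ nat (2 ℕ.^ j) → e ℚ.≤ nat 2 * x → P ℚ.≤ x * nat (2 ℕ.^ suc j)
scale-bound {P} {e} {x} j 0<e P/e≤2^j e≤2x = begin
  P                          ≡⟨ trans (sym (ℚ.*-identityʳ P)) (cong (P *_) (sym (inv-inverse e (>⇒≢0 0<e)))) ⟩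
  P * (e * inv e)            ≡⟨ solve 3 (λ p e i → p :* (e :* i) := p :* i :* e) refl P e (inv e) ⟩
  P * inv e * e              ≤⟨ *-mono-≤⁺ (0≤nat (2 ℕ.^ j)) (ℚ.<⇒≤ 0<e) P/e≤2^j e≤2x ⟩
  nat (2 ℕ.^ j) * (nat 2 * x) ≡⟨ solve 3 (λ a t x → a :* (t :* x) := x :* (t :* a)) refl (nat (2 ℕ.^ j)) (nat 2) x ⟩
  x * (nat 2 * nat (2 ℕ.^ j)) ≡⟨ cong (x *_) (sym (nat-* 2 (2 ℕ.^ j))) ⟩
  x * nat (2 ℕ.^ suc j)      ∎

-- Comparison of the number of steps with the logarithms

module _ (p : ℕ) .{{nz : NonZero p}} (3≤p : 3 ≤ p) (¬2∣p : ¬ 2 ∣ p) (ε : ℝ) (0<ε : 0ℝ <ℝ ε)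
         (e : ℚ) (0<e : 0ℚ ℚ.< e) (near : Eventually λ n → Near e (seq ε n))
         (i : ℕ) (p≤2^ : nat p ℚ.≤ nat (2 ℕ.^ (5 ℕ.+ i))) (i-scale : i ≡ 0 ⊎ nat (2 ℕ.^ (4 ℕ.+ i)) ℚ.≤ nat p)
         (j : ℕ) (p/e≤2^ : nat p * inv e ℚ.≤ nat (2 ℕ.^ (5 ℕ.+ j)))
         (j-scale : j ≡ 0 ⊎ nat (2 ℕ.^ (4 ℕ.+ j)) ℚ.≤ nat p * inv e) where

  private
    2≤p : nat 2 ℚ.≤ nat p
    2≤p = nat-mono (ℕ.≤-trans (ℕ.n≤1+n 2) 3≤p)

  steps : ℕ
  steps = mixing-steps (5 ℕ.+ i) (6 ℕ.+ j)

  -- Each late term of the sequence of ε serves as a rational tolerance of its own, while `steps`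
  -- depends only on `e`.
  separated : ∀ k → SeparatedWithin (pollardRho p k) (uniform p) ε steps
  separated k x y δ 0<δ = proj₁ near , λ n le →
    let open Near (proj₂ near n le)
    in ℚ.≤-trans
         (separation-bound p (p ℕ./ 2) (odd⇒≡ p ¬2∣p) k (5 ℕ.+ i) (nat-cancel-≤ p≤2^) (6 ℕ.+ j) (seq ε n)
           (ℚ.<⇒≤ 0<x) (scale-bound {nat p} {e} {seq ε n} (5 ℕ.+ j) 0<e p/e≤2^ e≤2x) x y)
         (≤-+ʳ (seq ε n) (ℚ.<⇒≤ 0<δ))

  log-p-lower : Eventually λ n → nat (suc i) * (ℤ.+ 1 / 4) ℚ.≤ seq (log (fromℕ p) (fromℕ-pos p {{nz}})) n
  log-p-lower = log-lower (fromℕ p) (fromℕ-pos p {{nz}}) i (0 , λ _ _ → 2≤p , large i-scale)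
    where
    large : i ≡ 0 ⊎ nat (2 ℕ.^ (4 ℕ.+ i)) ℚ.≤ nat p → i ≡ 0 ⊎ nat (2 ℕ.^ (3 ℕ.+ i)) ℚ.≤ nat p
    large (inj₁ i≡0) = inj₁ i≡0
    large (inj₂ le)  = inj₂ (ℚ.≤-trans (nat-mono (ℕ.^-monoʳ-≤ 2 (ℕ.n≤1+n (3 ℕ.+ i)))) le)

  log-p/ε-lower : Eventually λ n → nat (suc j) * (ℤ.+ 1 / 4) ℚ.≤ seq (log (fromℕ p ÷ℝ ε [ 0<ε ]) (÷ℝ-pos {fromℕ p} {ε} (fromℕ-pos p {{nz}}) 0<ε)) n
  log-p/ε-lower = log-lower (fromℕ p ÷ℝ ε [ 0<ε ]) (÷ℝ-pos {fromℕ p} {ε} (fromℕ-pos p {{nz}}) 0<ε) j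
    (proj₁ near , λ n le →
      let open Near (proj₂ near n le)
      in bounds 0<x x≤1 x≤2e j-scale)
    where
    bounds : ∀ {x} → 0ℚ ℚ.< x → x ℚ.≤ 1ℚ → x ℚ.≤ nat 2 * e → j ≡ 0 ⊎ nat (2 ℕ.^ (4 ℕ.+ j)) ℚ.≤ nat p * inv e →
      nat 2 ℚ.≤ nat p * inv x × (j ≡ 0 ⊎ nat (2 ℕ.^ (3 ℕ.+ j)) ℚ.≤ nat p * inv x)
    bounds {x} 0<x x≤1 x≤2e cond = (begin
        nat 2                ≤⟨ 2≤p ⟩
        nat p                ≡⟨ sym (ℚ.*-identityʳ (nat p)) ⟩
        nat p * 1ℚ           ≡⟨ cong (nat p *_) (sym (inv-inverse x (>⇒≢0 0<x))) ⟩
        nat p * (x * inv x)  ≤⟨ ℚ.*-monoˡ-≤-nonNeg (nat p) {{ℚ.nonNegative (0≤nat p)}}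
                                  (ℚ.*-monoʳ-≤-nonNeg (inv x) {{ℚ.nonNegative (ℚ.<⇒≤ (inv-pos 0<x))}} x≤1) ⟩
        nat p * (1ℚ * inv x) ≡⟨ cong (nat p *_) (ℚ.*-identityˡ (inv x)) ⟩
        nat p * inv x        ∎) , large cond
      where
      large : j ≡ 0 ⊎ nat (2 ℕ.^ (4 ℕ.+ j)) ℚ.≤ nat p * inv e → j ≡ 0 ⊎ nat (2 ℕ.^ (3 ℕ.+ j)) ℚ.≤ nat p * inv x
      large (inj₁ j≡0) = inj₁ j≡0
      large (inj₂ le)  = inj₂ (ℚ.*-cancelˡ-≤-pos (nat 2) (begin
        nat 2 * nat (2 ℕ.^ (3 ℕ.+ j)) ≡⟨ sym (nat-* 2 (2 ℕ.^ (3 ℕ.+ j))) ⟩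
        nat (2 ℕ.^ (4 ℕ.+ j))         ≤⟨ le ⟩
        nat p * inv e                 ≤⟨ ℚ.*-monoˡ-≤-nonNeg (nat p) {{ℚ.nonNegative (0≤nat p)}} (inv-doubling 0<e 0<x x≤2e) ⟩
        nat p * (nat 2 * inv x)       ≡⟨ solve 3 (λ p t v → p :* (t :* v) := t :* (p :* v)) refl (nat p) (nat 2) (inv x) ⟩
        nat 2 * (nat p * inv x)       ∎))

  -- 1244160 is 19440 · 4³, one factor 4 for each of the three logarithms. Allowing any `τ` up to
  -- `steps` covers both the exhibited time and the least one.
  steps-bound : ∀ τ → τ ≤ steps → fromℕ τ ≤ℝ fromℕ 1244160 *ℝ log (fromℕ p) (fromℕ-pos p {{nz}}) ^ℝ 2
    *ℝ log (fromℕ p ÷ℝ ε [ 0<ε ]) (÷ℝ-pos {fromℕ p} {ε} (fromℕ-pos p {{nz}}) 0<ε)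
  steps-bound τ τ≤steps δ 0<δ = both (λ {n} lp le → begin
    nat τ
      ≤⟨ nat-mono (ℕ.≤-trans τ≤steps (mixing-steps-bound i j)) ⟩
    nat (19440 ℕ.* (suc i ℕ.* suc i ℕ.* suc j))
      ≡⟨ trans (nat-* 19440 (suc i ℕ.* suc i ℕ.* suc j)) (cong (nat 19440 *_)
           (trans (nat-* (suc i ℕ.* suc i) (suc j)) (cong (_* nat (suc j)) (nat-* (suc i) (suc i))))) ⟩
    nat 19440 * (nat (suc i) * nat (suc i) * nat (suc j))
      ≡⟨ solve 2 (λ I J → con (nat 19440) :* (I :* I :* J)
           := con (nat 1244160) :* (I :* con (ℤ.+ 1 / 4) :* (I :* con (ℤ.+ 1 / 4) :* con 1ℚ)) :* (J :* con (ℤ.+ 1 / 4)))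
           refl (nat (suc i)) (nat (suc j)) ⟩
    nat 1244160 * (a * (a * 1ℚ)) * b
      ≤⟨ product-mono 0≤a 0≤b lp le ⟩
    nat 1244160 * (seq (log (fromℕ p) (fromℕ-pos p {{nz}})) n * (seq (log (fromℕ p) (fromℕ-pos p {{nz}})) n * 1ℚ)) * seq (log (fromℕ p ÷ℝ ε [ 0<ε ]) (÷ℝ-pos {fromℕ p} {ε} (fromℕ-pos p {{nz}}) 0<ε)) n
      ≤⟨ ≤-+ʳ (nat 1244160 * (seq (log (fromℕ p) (fromℕ-pos p {{nz}})) n * (seq (log (fromℕ p) (fromℕ-pos p {{nz}})) n * 1ℚ)) * seq (log (fromℕ p ÷ℝ ε [ 0<ε ]) (÷ℝ-pos {fromℕ p} {ε} (fromℕ-pos p {{nz}}) 0<ε)) n) (ℚ.<⇒≤ 0<δ) ⟩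
    nat 1244160 * (seq (log (fromℕ p) (fromℕ-pos p {{nz}})) n * (seq (log (fromℕ p) (fromℕ-pos p {{nz}})) n * 1ℚ)) * seq (log (fromℕ p ÷ℝ ε [ 0<ε ]) (÷ℝ-pos {fromℕ p} {ε} (fromℕ-pos p {{nz}}) 0<ε)) n + δ ∎)
    log-p-lower log-p/ε-lower
    where
    a = nat (suc i) * (ℤ.+ 1 / 4)
    b = nat (suc j) * (ℤ.+ 1 / 4)
    0≤a = 0≤* (0≤nat (suc i)) (ℚ.nonNegative⁻¹ (ℤ.+ 1 / 4))
    0≤b = 0≤* (0≤nat (suc j)) (ℚ.nonNegative⁻¹ (ℤ.+ 1 / 4))
    product-mono : ∀ {a b x y} → 0ℚ ℚ.≤ a → 0ℚ ℚ.≤ b → a ℚ.≤ x → b ℚ.≤ y →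
      nat 1244160 * (a * (a * 1ℚ)) * b ℚ.≤ nat 1244160 * (x * (x * 1ℚ)) * y
    product-mono {a} {b} {x} {y} 0≤a 0≤b a≤x b≤y =
      *-mono-≤⁺ (0≤* (0≤nat 1244160) (0≤* 0≤x (0≤* 0≤x (ℚ.<⇒≤ 0<1)))) 0≤b
        (ℚ.*-monoˡ-≤-nonNeg (nat 1244160) (*-mono-≤⁺ 0≤x (0≤* 0≤a (ℚ.<⇒≤ 0<1)) a≤x
          (ℚ.*-monoʳ-≤-nonNeg 1ℚ a≤x))) b≤y
      where
      0≤x = ℚ.≤-trans 0≤a a≤x

mainTheorem4 : ∃[ C ] ∀ (p : ℕ) .{{_ : NonZero p}} → 3 ≤ p → ¬ 2 ∣ p →
    (k : Fin p) (ε : ℝ) (0<ε : 0ℝ <ℝ ε) → ε <ℝ 1ℝ →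
    MixingTimeAtMost (pollardRho p k) (uniform p) ε
    (C *ℝ log (fromℕ p) (fromℕ-pos p) ^ℝ 2
    *ℝ log (fromℕ p ÷ℝ ε [ 0<ε ]) (÷ℝ-pos {fromℕ p} {ε} (fromℕ-pos p) 0<ε))
mainTheorem4 = fromℕ 1244160 , λ p {{nz}} 3≤p ¬2∣p k ε 0<ε ε<1 →
  let e , 0<e , near = approximate ε 0<ε ε<1
      i , p≤2^ , i-scale = dyadic-scale (nat p)
      j , p/e≤2^ , j-scale = dyadic-scale (nat p * inv e)
      m = mixing-steps (5 ℕ.+ i) (6 ℕ.+ j)
      bound = steps-bound p {{nz}} 3≤p ¬2∣p ε 0<ε e 0<e near i p≤2^ i-scale j p/e≤2^ j-scale
      sep = separated p {{nz}} 3≤p ¬2∣p ε 0<ε e 0<e near i p≤2^ i-scale j p/e≤2^ j-scale k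
  in (m , sep , bound m ℕ.≤-refl) , λ τ (_ , least) → bound τ (least m sep)
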